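{- For every prime $p$, every skew morphism of the cyclic group $\mathrm{C}_{8p}$ is coset-preserving.
   Context: For a finite group $B$, a skew morphism of $B$ is a permutation $\varphi$ of $B$ fixing the identity such that for every $a\in B$ there is a positive integer $i_a$ with $\varphi(ab)=\varphi(a)\varphi^{i_a}(b)$ for all $b\in B$. Its order $\mathrm{ord}(\varphi)$ is the order of $\langle\varphi\rangle$. The power function $\pi$ maps $a$ to the unique such $i_a\in\{1,\dots,\mathrm{ord}(\varphi)\}$ (with $\pi\equiv1$ for the identity). $\varphi$ is coset-preserving if $\pi(\varphi(a))=\pi(a)$ for all $a\in B$. -}

module Defs where

open import Data.Nat using (ℕ; zero; suc; _+_; _≤_; _<_)
open import Data.Nat.DivMod using (_%_; m%n<n)
open import Data.Fin using (Fin; toℕ; fromℕ<)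
open import Data.Fin.Permutation using (Permutation′; _⟨$⟩ʳ_)
open import Data.Product using (Σ; _×_)
open import Relation.Binary.PropositionalEquality using (_≡_; _≢_)

-- The cyclic group C_n (n = suc k) realised as ℤ/nℤ on Fin (suc k):
-- identity 0, operation addition modulo n.
_⊕_ : ∀ {k} → Fin (suc k) → Fin (suc k) → Fin (suc k)
_⊕_ {k} a b = fromℕ< (m%n<n (toℕ a + toℕ b) (suc k))

iter : ∀ {A : Set} → (A → A) → ℕ → A → A
iter f zero    x = x
iter f (suc i) x = f (iter f i x)

pow : ∀ {k} → Permutation′ (suc k) → ℕ → Fin (suc k) → Fin (suc k)
pow φ i = iter (φ ⟨$⟩ʳ_) i

PowerAt : ∀ {k} → Permutation′ (suc k) → Fin (suc k) → ℕ → Set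
PowerAt φ a i = ∀ b → φ ⟨$⟩ʳ (a ⊕ b) ≡ (φ ⟨$⟩ʳ a) ⊕ pow φ i b

IsSkewMorphism : ∀ {k} → Permutation′ (suc k) → Set
IsSkewMorphism φ =
  (φ ⟨$⟩ʳ Fin.zero ≡ Fin.zero) × (∀ a → Σ ℕ λ i → (1 ≤ i) × PowerAt φ a i)

IsOrder : ∀ {k} → Permutation′ (suc k) → ℕ → Set
IsOrder φ m =
  (1 ≤ m) × (∀ x → pow φ m x ≡ x)
  × (∀ j → 1 ≤ j → j < m → Σ (Fin _) λ x → pow φ j x ≢ x)

-- π(a) = i  : i is the unique power for a lying in {1, …, ord φ}
IsPowerFunctionValue : ∀ {k} → Permutation′ (suc k) → Fin (suc k) → ℕ → Set
IsPowerFunctionValue φ a i =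
  Σ ℕ λ m → IsOrder φ m × (1 ≤ i) × (i ≤ m) × PowerAt φ a i

IsCosetPreserving : ∀ {k} → Permutation′ (suc k) → Set
IsCosetPreserving φ = ∀ a i j →
  IsPowerFunctionValue φ a i → IsPowerFunctionValue φ (φ ⟨$⟩ʳ a) j → i ≡ j

{-# OPTIONS --safe #-}
-- Lift a skew morphism of C_n to a map f on the integers that respects congruence modulo n. If rℤ is the
-- preimage of the kernel of the power function π, then the same f, read modulo r, is the induced
-- quotient skew morphism, and "coset-preserving" means f(1) ≡ 1 (mod r). Argue by induction over the
-- divisors n of 8p: assume f mod r is coset-preserving, with kernel index r′, but f(1) ≢ 1 (mod r).
-- Put k = n/r and k′ = r/r′, let m and q be the orders of f modulo n and modulo r, and let D be the order
-- of f acting on ℤ/r and on the kernel simultaneously. Then D ∣ m ∣ kD, and π ≡ 1 (mod D) on r′ℤ.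
-- Counting values of π and points of the orbit of 1 gives q ≤ k′ ≤ m/D ≤ k and k′ ≥ 3, so
-- n ∣ 8p forces r′ ≤ 2, with few possibilities for k and k′. In each of them w = f(1) − 1
-- satisfies k′(π(w) − 1) ≡ 0 (mod m), which puts w into the kernel as soon as k and k′ are coprime; the
-- remaining possibilities k′ = 4, k ∈ {2p, 4} are excluded by congruences modulo 2p and 16.
module Submission where

-- Why one congruence expresses the claim: modulo m, π takes equal values exactly on classes modulo
-- r, and a power of f that fixes 1 modulo r fixes all of ℤ/r. The first fact also gives r ≤ m < n,
-- so passing to the quotient descends. The bounds come from coordinates. Since f is the identity
-- modulo r′, the iterates of 1 modulo r lie in 1 + r′ℤ, which leaves k′ places. On r′ℤ one has π =
-- 1 + F·D with F modulo m/D, and π separates classes modulo r. Finally f^D moves 1 by a kernel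
-- element that it fixes, so its powers act on 1 as translations. The constant 8 enters through kk′
-- ≥ 9: if p divided neither k nor k′, then kk′ would divide 8. The obstacle is that f need not be
-- additive, so π(w) alone says little about π(jw). When r′ = 1, F is a crossed homomorphism whose
-- multiplier agrees at 1 and at f(1) = 1 + w; commutativity of addition then makes F linear on
-- multiples of w. When r′ = 2 and f fixes the even residues modulo r, π is multiplicative on even
-- numbers and (π(w) - 1)² ≡ 0 (mod m), which linearises π(jw) in the same way.

open import Defs
open import Data.Empty using (⊥)
open import Data.Fin using (Fin; toℕ; fromℕ<)
open import Data.Fin.Permutation using (Permutation′; _⟨$⟩ʳ_)
open import Data.Fin.Properties using (toℕ-injective; toℕ<n; toℕ-fromℕ<; injective⇒≤)
open import Data.Integer using (ℤ; +_; -[1+_]; _+_; _-_; _*_; -_)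
open import Data.Integer.DivMod using (_%ℕ_; _/ℕ_; n%ℕd<d; a≡a%ℕn+[a/ℕn]*n)
open import Data.Integer.Divisibility.Signed as ℤ∣ using (∣⇒∣ᵤ)
open import Data.Integer.Properties as ℤₚ using (pos-+; pos-*)
open import Data.Integer.Tactic.RingSolver using (solve-∀)
open import Data.Nat as ℕ using (ℕ; zero; suc; _≤_; _<_; z≤n; s≤s; NonZero; _∸_)
open import Data.Nat.Coprimality using (Coprime; coprime-divisor; coprime?; prime⇒coprime)
open import Data.Nat.DivMod using (_%_; m%n<n; m≡m%n+[m/n]*n)
open import Data.Nat.Divisibility as ℕ∣ using (_∣_; divides; ∣⇒≤)
open import Data.Nat.Induction using (<-rec)
open import Data.Nat.Primality using (Prime; euclidsLemma; prime⇒irreducible; prime⇒nonTrivial; prime⇒nonZero; prime?)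
open import Data.Nat.Properties as ℕₚ using (anyUpTo?; allUpTo?)
open import Data.Nat.Tactic.RingSolver renaming (solve-∀ to ℕ-solve-∀)
open import Data.Product using (∃-syntax; _×_; _,_; proj₁; proj₂)
open import Data.Sum using (_⊎_; inj₁; inj₂; [_,_]′)
open import Function using (_∘_; id)
open import Relation.Binary.Bundles using (Setoid)
open import Relation.Binary.Definitions using (tri<; tri≈; tri>)
open import Relation.Binary.PropositionalEquality hiding (resp)
open import Relation.Nullary using (Dec; yes; no; ¬_; contradiction)
open import Relation.Nullary.Decidable using (False; toWitnessFalse; map′; _×-dec_; _⊎-dec_; _→-dec_; from-yes; decidable-stable)

-- Congruences of integers

infix 4 _≈_[_] _≈?_[_]

-- The quotient is kept as data: later coordinates, such as half of f(1) - 1, are read off from it.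
record _≈_[_] (a b : ℤ) (n : ℕ) : Set where
  constructor witness
  field
    quotient : ℤ
    equality : a - b ≡ quotient * + n

private variable
  a b c d a′ b′ : ℤ
  n : ℕ

-- Many congruences below hold because a - b is an explicit integer combination of known
-- differences; only that polynomial identity is left to the ring solver.
combine₁ : ∀ k → a - b ≡ k * (c - d) → c ≈ d [ n ] → a ≈ b [ n ]
combine₁ {n = n} k e (witness q e′) = witness (k * q)
  (trans e (trans (cong (k *_) e′) (sym (ℤₚ.*-assoc k q (+ n)))))

combine₂ : ∀ k l → a - b ≡ k * (c - d) + l * (a′ - b′) →
           c ≈ d [ n ] → a′ ≈ b′ [ n ] → a ≈ b [ n ]
combine₂ {n = n} k l e (witness q e₁) (witness r e₂) = witness (k * q + l * r)
  (trans e (trans (cong₂ (λ x y → k * x + l * y) e₁ e₂) (shape k l q r (+ n))))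
  where
  shape : ∀ k l q r n → k * (q * n) + l * (r * n) ≡ (k * q + l * r) * n
  shape = solve-∀

combine₃ : ∀ {e e′} k l m → a - b ≡ k * (c - d) + l * (a′ - b′) + m * (e - e′) →
           c ≈ d [ n ] → a′ ≈ b′ [ n ] → e ≈ e′ [ n ] → a ≈ b [ n ]
combine₃ {n = n} k l m h (witness q e₁) (witness r e₂) (witness s e₃) = witness (k * q + l * r + m * s)
  (trans h (trans (cong₂ _+_ (cong₂ (λ x y → k * x + l * y) e₁ e₂) (cong (m *_) e₃)) (shape k l m q r s (+ n))))
  where
  shape : ∀ k l m q r s n → k * (q * n) + l * (r * n) + m * (s * n) ≡ (k * q + l * r + m * s) * n
  shape = solve-∀

≈-reflexive : a ≡ b → a ≈ b [ n ]
≈-reflexive {a} {n = n} refl = witness (+ 0) (shape a (+ n))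
  where
  shape : ∀ a n → a - a ≡ + 0 * n
  shape = solve-∀

≈-refl : a ≈ a [ n ]
≈-refl = ≈-reflexive refl

≈-sym : a ≈ b [ n ] → b ≈ a [ n ]
≈-sym {a} {b} = combine₁ (- + 1) (shape a b)
  where
  shape : ∀ a b → b - a ≡ - + 1 * (a - b)
  shape = solve-∀

≈-trans : a ≈ b [ n ] → b ≈ c [ n ] → a ≈ c [ n ]
≈-trans {a} {b} {c = c} = combine₂ (+ 1) (+ 1) (shape a b c)
  where
  shape : ∀ a b c → a - c ≡ + 1 * (a - b) + + 1 * (b - c)
  shape = solve-∀

+-cong : a ≈ b [ n ] → c ≈ d [ n ] → a + c ≈ b + d [ n ]
+-cong {a} {b} {c = c} {d} = combine₂ (+ 1) (+ 1) (shape a b c d)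
  where
  shape : ∀ a b c d → (a + c) - (b + d) ≡ + 1 * (a - b) + + 1 * (c - d)
  shape = solve-∀

*-cong : a ≈ b [ n ] → c ≈ d [ n ] → a * c ≈ b * d [ n ]
*-cong {a} {b} {c = c} {d} = combine₂ c b (shape a b c d)
  where
  shape : ∀ a b c d → a * c - b * d ≡ c * (a - b) + b * (c - d)
  shape = solve-∀

+-congˡ : ∀ c → a ≈ b [ n ] → c + a ≈ c + b [ n ]
+-congˡ c = +-cong (≈-refl {c})

*-congˡ : ∀ c → a ≈ b [ n ] → c * a ≈ c * b [ n ]
*-congˡ c = *-cong (≈-refl {c})

+-congʳ : ∀ c → a ≈ b [ n ] → a + c ≈ b + c [ n ]
+-congʳ c e = +-cong e (≈-refl {c})

*-congʳ : ∀ c → a ≈ b [ n ] → a * c ≈ b * c [ n ]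
*-congʳ c e = *-cong e (≈-refl {c})

+-cancelˡ : ∀ c → c + a ≈ c + b [ n ] → a ≈ b [ n ]
+-cancelˡ {a} {b} c = combine₁ (+ 1) (shape a b c)
  where
  shape : ∀ a b c → a - b ≡ + 1 * ((c + a) - (c + b))
  shape = solve-∀

≈-setoid : ℕ → Setoid _ _
≈-setoid n = record
  { Carrier = ℤ
  ; _≈_ = _≈_[ n ]
  ; isEquivalence = record { refl = ≈-refl ; sym = ≈-sym ; trans = ≈-trans }
  }

module ≈-Reasoning (n : ℕ) where
  open import Relation.Binary.Reasoning.Setoid (≈-setoid n) public

∣⇒≈ : ∀ {x} → n ∣ x → + x ≈ + 0 [ n ]
∣⇒≈ {n} {x} (divides q e) = witness (+ q)
  (trans (ℤₚ.+-identityʳ (+ x)) (trans (cong +_ e) (pos-* q n)))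

≈⇒∣ : ∀ {x} → + x ≈ + 0 [ n ] → n ∣ x
≈⇒∣ {n} {x} (witness q e) =
  ∣⇒∣ᵤ (ℤ∣.divides q (trans (sym (ℤₚ.+-identityʳ (+ x))) e))

weaken : ∀ {r} → r ∣ n → a ≈ b [ n ] → a ≈ b [ r ]
weaken {n} {r = r} (divides k e) (witness q e′) = witness (q * + k)
  (trans e′ (trans (cong (λ x → q * + x) e) (trans (cong (q *_) (pos-* k r)) (sym (ℤₚ.*-assoc q (+ k) (+ r))))))

scale : ∀ c → a ≈ b [ n ] → a * + c ≈ b * + c [ n ℕ.* c ]
scale {a} {b} {n} c (witness q e) = witness q
  (trans (shape a b (+ c)) (trans (cong (_* + c) e)
    (trans (ℤₚ.*-assoc q (+ n) (+ c)) (cong (q *_) (sym (pos-* n c))))))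
  where
  shape : ∀ a b c → a * c - b * c ≡ (a - b) * c
  shape = solve-∀

unscale : ∀ c .{{_ : NonZero c}} → a * + c ≈ b * + c [ n ℕ.* c ] → a ≈ b [ n ]
unscale {a} {b} {n} c@(suc _) (witness q e) = witness q
  (ℤₚ.*-cancelʳ-≡ (a - b) (q * + n) (+ c)
    (trans (shape a b (+ c)) (trans e (trans (cong (q *_) (pos-* n c)) (sym (ℤₚ.*-assoc q (+ n) (+ c)))))))
  where
  shape : ∀ a b c → (a - b) * c ≡ a * c - b * c
  shape = solve-∀

_≈?_[_] : ∀ a b n → Dec (a ≈ b [ n ])
a ≈? b [ n ] = map′ (λ d → witness (ℤ∣.quotient d) (ℤ∣._∣_.equality d))
  (λ e → ℤ∣.divides (_≈_[_].quotient e) (_≈_[_].equality e)) (+ n ℤ∣.∣? a - b)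

≈-residue : ∀ a n .{{_ : NonZero n}} → a ≈ + (a %ℕ n) [ n ]
≈-residue a n = witness (a /ℕ n)
  (trans (cong (_- + (a %ℕ n)) (a≡a%ℕn+[a/ℕn]*n a n)) (shape (+ (a %ℕ n)) (a /ℕ n * + n)))
  where
  shape : ∀ x y → (x + y) - x ≡ y
  shape = solve-∀

difference : ∀ {i j} → i ≤ j → + i ≈ + j [ n ] → n ∣ j ∸ i
difference {n} {i} {j} i≤j e = ≈⇒∣ (combine₁ (- + 1) (trans (cong (_- + 0) (sym (ℤₚ.⊖-≥ i≤j)))
  (trans (cong (_- + 0) (sym (ℤₚ.m-n≡m⊖n j i))) (shape (+ i) (+ j)))) e)
  where
  shape : ∀ i j → (j - i) - + 0 ≡ - + 1 * (i - j)
  shape = solve-∀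

small-≤ : ∀ {i j} → i ≤ j → j < n → + i ≈ + j [ n ] → i ≡ j
small-≤ {n} {i} {j} i≤j j<n e with j ∸ i in eq | difference i≤j e
... | zero  | _ = ℕₚ.≤-antisym i≤j (ℕₚ.m∸n≡0⇒m≤n eq)
... | suc x | n∣ = contradiction
  (ℕₚ.≤-trans (∣⇒≤ n∣) (ℕₚ.≤-trans (ℕₚ.≤-reflexive (sym eq)) (ℕₚ.m∸n≤m j i))) (ℕₚ.<⇒≱ j<n)

small : ∀ {i j} → i < n → j < n → + i ≈ + j [ n ] → i ≡ j
small {i = i} {j} i<n j<n e with ℕₚ.≤-total i j
... | inj₁ i≤j = small-≤ i≤j j<n e
... | inj₂ j≤i = sym (small-≤ j≤i i<n (≈-sym e))

pigeonhole : ∀ N M .{{_ : NonZero M}} (g : ℕ → ℤ) →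
  (∀ i j → i < j → j < N → ¬ g i ≈ g j [ M ]) → N ≤ M
pigeonhole N M g distinct = injective⇒≤ {f = h} h-injective
  where
  h : Fin N → Fin M
  h i = fromℕ< (n%ℕd<d (g (toℕ i)) M)

  same : ∀ i j → h i ≡ h j → g (toℕ i) ≈ g (toℕ j) [ M ]
  same i j e = ≈-trans (≈-residue _ M) (≈-trans (≈-reflexive (cong +_ residues)) (≈-sym (≈-residue _ M)))
    where
    residues : g (toℕ i) %ℕ M ≡ g (toℕ j) %ℕ M
    residues = trans (sym (toℕ-fromℕ< _)) (trans (cong toℕ e) (toℕ-fromℕ< _))

  h-injective : ∀ {i j} → h i ≡ h j → i ≡ j
  h-injective {i} {j} e with ℕₚ.<-cmp (toℕ i) (toℕ j)
  ... | tri< i<j _ _ = contradiction (same i j e) (distinct _ _ i<j (toℕ<n j))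
  ... | tri≈ _ i≡j _ = toℕ-injective i≡j
  ... | tri> _ _ j<i = contradiction (≈-sym (same i j e)) (distinct _ _ j<i (toℕ<n i))

cancel-coprime : ∀ {r} .{{_ : NonZero n}} → Coprime n r → ∀ x → + r * x ≈ + 0 [ n ] → x ≈ + 0 [ n ]
cancel-coprime {n} {r} c x e = ≈-trans (≈-residue x n) (∣⇒≈ (coprime-divisor c (≈⇒∣ (subst (_≈ + 0 [ n ])
  (sym (pos-* r (x %ℕ n))) (≈-trans (*-congˡ (+ r) (≈-sym (≈-residue x n))) e)))))

record LeastPeriod (P : ℕ → Set) : Set where
  field
    period   : ℕ
    positive : 1 ≤ period
    holds    : P period
    least    : ∀ j → P j → period ∣ j

abstract
  -- Strong recursion replaces `N` by any smaller positive solution. Once none is left, subtracting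
  -- `N` repeatedly from a solution, which `cancel` permits, can only end at 0.
  leastPeriod : ∀ {P : ℕ → Set} → (∀ j → Dec (P j)) → (∀ i j → P (i ℕ.+ j) → P i → P j) →
    ∀ N → 1 ≤ N → P N → LeastPeriod P
  leastPeriod {P} P? cancel = <-rec _ search
    where
    search : ∀ N → (∀ {M} → M < N → 1 ≤ M → P M → LeastPeriod P) → 1 ≤ N → P N → LeastPeriod P
    search N rec 1≤N PN with anyUpTo? (λ j → (1 ℕ.≤? j) ×-dec P? j) N
    ... | yes (M , M<N , 1≤M , PM) = rec M<N 1≤M PM
    ... | no none = record { period = N ; positive = 1≤N ; holds = PN ; least = <-rec _ descend }
      where
      descend : ∀ j → (∀ {i} → i < j → P i → N ∣ i) → P j → N ∣ j
      descend zero _ _ = N ℕ∣.∣0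
      descend j@(suc _) below Pj with N ℕ.≤? j
      ... | no N≰j = contradiction (j , ℕₚ.≰⇒> N≰j , s≤s z≤n , Pj) none
      ... | yes N≤j = subst (N ∣_) (ℕₚ.m+[n∸m]≡n N≤j) (ℕ∣.∣m∣n⇒∣m+n ℕ∣.∣-refl
        (below (ℕₚ.∸-monoʳ-< 1≤N N≤j) (cancel N (j ∸ N) (subst P (sym (ℕₚ.m+[n∸m]≡n N≤j)) Pj) PN)))

-- Skew morphisms of cyclic groups, lifted to the integers

iter-+ : ∀ {A : Set} (f : A → A) i j x → iter f (i ℕ.+ j) x ≡ iter f i (iter f j x)
iter-+ f zero    j x = refl
iter-+ f (suc i) j x = cong f (iter-+ f i j x)

-- `π` is any choice of positive exponents and `N` any common period, neither normalised, so that
-- both pass unchanged to the quotient.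
record Skew (n : ℕ) (f : ℤ → ℤ) : Set where
  field
    nonZero : NonZero n
    resp    : a ≈ b [ n ] → f a ≈ f b [ n ]
    fixes-0 : f (+ 0) ≈ + 0 [ n ]
    π       : ℤ → ℕ
    π≥1     : ∀ a → 1 ≤ π a
    skew    : ∀ a b → f (a + b) ≈ f a + iter f (π a) b [ n ]
    N       : ℕ
    N≥1     : 1 ≤ N
    f^N     : ∀ a → iter f N a ≈ a [ n ]

module SkewTheory {n : ℕ} {f : ℤ → ℤ} (S : Skew n f) where
  open Skew S public
  instance
    n-nonZero : NonZero n
    n-nonZero = nonZero

  iter-resp : ∀ i → a ≈ b [ n ] → iter f i a ≈ iter f i b [ n ]
  iter-resp zero    e = e
  iter-resp (suc i) e = resp (iter-resp i e)

  iter-0 : ∀ i → iter f i (+ 0) ≈ + 0 [ n ]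
  iter-0 zero    = ≈-refl
  iter-0 (suc i) = ≈-trans (resp (iter-0 i)) fixes-0

  Fixes : ℕ → Set
  Fixes j = ∀ a → iter f j a ≈ a [ n ]

  fixes-from-residues : ∀ j → (∀ b → iter f j (+ b) ≈ + b [ n ]) → Fixes j
  fixes-from-residues j h a = begin
    iter f j a             ≈⟨ iter-resp j (≈-residue a n) ⟩
    iter f j (+ (a %ℕ n))  ≈⟨ h _ ⟩
    + (a %ℕ n)             ≈⟨ ≈-residue a n ⟨
    a                      ∎
    where open ≈-Reasoning n

  Fixes? : ∀ j → Dec (Fixes j)
  Fixes? j = map′ to from (allUpTo? (λ b → iter f j (+ b) ≈? + b [ n ]) n)
    where
    to : (∀ {b} → b < n → iter f j (+ b) ≈ + b [ n ]) → Fixes j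
    to h a = ≈-trans (iter-resp j (≈-residue a n)) (≈-trans (h (n%ℕd<d a n)) (≈-sym (≈-residue a n)))

    from : Fixes j → ∀ {b} → b < n → iter f j (+ b) ≈ + b [ n ]
    from h _ = h _

  abstract
    order : LeastPeriod Fixes
    order = leastPeriod Fixes? cancel N N≥1 f^N
      where
      cancel : ∀ i j → Fixes (i ℕ.+ j) → Fixes i → Fixes j
      cancel i j hij hi a = ≈-trans (≈-sym (hi _)) (≈-trans (≈-reflexive (sym (iter-+ f i j a))) (hij a))

  open LeastPeriod order public
    renaming (period to m; positive to m≥1; holds to f^m; least to m-least)

  instance
    m-nonZero : NonZero m
    m-nonZero = ℕ.>-nonZero m≥1

  iter-injective : ∀ i → iter f i a ≈ iter f i b [ n ] → a ≈ b [ n ]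
  iter-injective {a} {b} i e = ≈-trans (≈-sym (cycle a)) (≈-trans (iter-resp (i ℕ.* m ∸ i) e) (cycle b))
    where
    multiple : ∀ j → Fixes (j ℕ.* m)
    multiple zero    x = ≈-refl
    multiple (suc j) x = ≈-trans (≈-reflexive (iter-+ f m (j ℕ.* m) x)) (≈-trans (f^m _) (multiple j x))

    cycle : ∀ x → iter f (i ℕ.* m ∸ i) (iter f i x) ≈ x [ n ]
    cycle x = ≈-trans (≈-reflexive (trans (sym (iter-+ f (i ℕ.* m ∸ i) i x))
      (cong (λ k → iter f k x) (ℕₚ.m∸n+n≡m (ℕₚ.m≤m*n i m))))) (multiple i x)

  injective : f a ≈ f b [ n ] → a ≈ b [ n ]
  injective = iter-injective 1

  iter-multiple : ∀ {ℓ} j → iter f ℓ a ≈ a [ n ] → iter f (j ℕ.* ℓ) a ≈ a [ n ]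
  iter-multiple         zero    e = ≈-refl
  iter-multiple {a} {ℓ} (suc j) e = ≈-trans (≈-reflexive (iter-+ f ℓ (j ℕ.* ℓ) a))
    (≈-trans (iter-resp ℓ (iter-multiple j e)) e)

  σ : ℕ → ℤ → ℕ
  σ zero    b = 0
  σ (suc y) b = π (iter f y b) ℕ.+ σ y b

  iter-skew : ∀ y b c → iter f y (b + c) ≈ iter f y b + iter f (σ y b) c [ n ]
  iter-skew zero    b c = ≈-refl
  iter-skew (suc y) b c = begin
    f (iter f y (b + c))                                            ≈⟨ resp (iter-skew y b c) ⟩
    f (iter f y b + iter f (σ y b) c)                               ≈⟨ skew _ _ ⟩
    iter f (suc y) b + iter f (π (iter f y b)) (iter f (σ y b) c)   ≡⟨ cong (λ z → iter f (suc y) b + z) (iter-+ f (π (iter f y b)) (σ y b) c) ⟨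
    iter f (suc y) b + iter f (σ (suc y) b) c                       ∎
    where open ≈-Reasoning n

  abstract
    orbit-of-1 : LeastPeriod (λ j → iter f j (+ 1) ≈ + 1 [ n ])
    orbit-of-1 = leastPeriod (λ j → iter f j (+ 1) ≈? + 1 [ n ]) cancel m m≥1 (f^m (+ 1))
      where
      cancel : ∀ i j → iter f (i ℕ.+ j) (+ 1) ≈ + 1 [ n ] → iter f i (+ 1) ≈ + 1 [ n ] → iter f j (+ 1) ≈ + 1 [ n ]
      cancel i j hij hi = iter-injective i
        (≈-trans (≈-reflexive (sym (iter-+ f i j (+ 1)))) (≈-trans hij (≈-sym hi)))

  -- With ℓ the orbit length of 1 and m = jℓ, the relation f^ℓ(1 + b) = 1 + f^s(b) gives f^{js} = id,
  -- hence ℓ ∣ s; so f^ℓ fixes 1 + b as soon as all powers of f^ℓ fix b.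
  private
    ℓ s : ℕ
    ℓ = LeastPeriod.period orbit-of-1
    s = σ ℓ (+ 1)

  orbit-shift : ∀ i b → iter f (i ℕ.* ℓ) (+ 1 + b) ≈ + 1 + iter f (i ℕ.* s) b [ n ]
  orbit-shift zero    b = ≈-refl
  orbit-shift (suc i) b = begin
    iter f (ℓ ℕ.+ i ℕ.* ℓ) (+ 1 + b)         ≡⟨ iter-+ f ℓ (i ℕ.* ℓ) _ ⟩
    iter f ℓ (iter f (i ℕ.* ℓ) (+ 1 + b))    ≈⟨ iter-resp ℓ (orbit-shift i b) ⟩
    iter f ℓ (+ 1 + iter f (i ℕ.* s) b)      ≈⟨ iter-skew ℓ (+ 1) _ ⟩
    iter f ℓ (+ 1) + iter f s (iter f (i ℕ.* s) b)
      ≈⟨ +-congʳ _ (LeastPeriod.holds orbit-of-1) ⟩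
    + 1 + iter f s (iter f (i ℕ.* s) b)      ≡⟨ cong (λ z → + 1 + z) (iter-+ f s (i ℕ.* s) b) ⟨
    + 1 + iter f (suc i ℕ.* s) b             ∎
    where open ≈-Reasoning n

  ℓ∣s : ℓ ∣ s
  ℓ∣s = cancel (LeastPeriod.least orbit-of-1 m (f^m (+ 1)))
    where
    cancel : ℓ ∣ m → ℓ ∣ s
    cancel (divides j m≡jℓ) = ℕ∣.*-cancelˡ-∣ j (subst (_∣ j ℕ.* s) m≡jℓ (m-least (j ℕ.* s) js-fixes))
      where
      instance
        j-nonZero : NonZero j
        j-nonZero = ℕ.≢-nonZero λ { refl → ℕ.≢-nonZero⁻¹ m m≡jℓ }

      js-fixes : Fixes (j ℕ.* s)
      js-fixes b = +-cancelˡ (+ 1) (≈-trans (≈-sym (orbit-shift j b))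
        (subst (λ k → iter f k (+ 1 + b) ≈ + 1 + b [ n ]) m≡jℓ (f^m (+ 1 + b))))

  orbit-fixes : ∀ b i → iter f (i ℕ.* ℓ) (+ b) ≈ + b [ n ]
  orbit-fixes zero    i = iter-0 (i ℕ.* ℓ)
  orbit-fixes (suc b) i = ≈-trans (orbit-shift i (+ b)) (+-congˡ (+ 1)
    (subst (λ k → iter f k (+ b) ≈ + b [ n ]) (sym is≡) (orbit-fixes b (i ℕ.* t))))
    where
    t : ℕ
    t = ℕ∣.quotient ℓ∣s
    is≡ : i ℕ.* s ≡ i ℕ.* t ℕ.* ℓ
    is≡ = trans (cong (i ℕ.*_) (ℕ∣._∣_.equality ℓ∣s)) (sym (ℕₚ.*-assoc i t ℓ))

  -- Makes `m` the length of the orbit of 1, so that exponents modulo `m` can be compared at 1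
  -- alone.
  fixes-1⇒Fixes : ∀ i → iter f i (+ 1) ≈ + 1 [ n ] → Fixes i
  fixes-1⇒Fixes i h = fixes-from-residues i λ b →
    subst (λ k → iter f k (+ b) ≈ + b [ n ]) (sym (ℕ∣._∣_.equality ℓ∣i)) (orbit-fixes b (ℕ∣.quotient ℓ∣i))
    where
    ℓ∣i : ℓ ∣ i
    ℓ∣i = LeastPeriod.least orbit-of-1 i h

  exponent-+ : ∀ i {d} → m ∣ d → ∀ a → iter f (i ℕ.+ d) a ≈ iter f i a [ n ]
  exponent-+ i {d} (divides k refl) a = ≈-trans (≈-reflexive (iter-+ f i d a))
    (iter-resp i (iter-multiple k (f^m a)))

  private
    exponent-resp-≤ : ∀ {i j} → i ≤ j → + i ≈ + j [ m ] → ∀ a → iter f j a ≈ iter f i a [ n ]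
    exponent-resp-≤ {i} {j} i≤j e a = subst (λ k → iter f k a ≈ iter f i a [ n ]) (ℕₚ.m+[n∸m]≡n i≤j)
                     (exponent-+ i (difference i≤j e) a)

  exponent-resp : ∀ {i j} → + i ≈ + j [ m ] → ∀ a → iter f i a ≈ iter f j a [ n ]
  exponent-resp {i} {j} e a = [ (λ i≤j → ≈-sym (exponent-resp-≤ i≤j e a))
                              , (λ j≤i → exponent-resp-≤ j≤i (≈-sym e) a) ]′ (ℕₚ.≤-total i j)

  private
    exponent-≤ : ∀ {i j} → i ≤ j → iter f i (+ 1) ≈ iter f j (+ 1) [ n ] → + i ≈ + j [ m ]
    exponent-≤ {i} {j} i≤j e = begin
      + i              ≡⟨ ℤₚ.+-identityʳ (+ i) ⟨
      + i + + 0        ≈⟨ +-congˡ (+ i) (∣⇒≈ (m-least (j ∸ i) (fixes-1⇒Fixes (j ∸ i) fixed))) ⟨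
      + i + + (j ∸ i)  ≡⟨ cong +_ (ℕₚ.m+[n∸m]≡n i≤j) ⟩
      + j              ∎
      where
      open ≈-Reasoning m
      cancelled : iter f i (iter f (j ∸ i) (+ 1)) ≈ iter f i (+ 1) [ n ]
      cancelled = subst (λ x → x ≈ iter f i (+ 1) [ n ])
        (trans (cong (λ k → iter f k (+ 1)) (sym (ℕₚ.m+[n∸m]≡n i≤j))) (iter-+ f i (j ∸ i) (+ 1)))
        (≈-sym e)
      fixed : iter f (j ∸ i) (+ 1) ≈ + 1 [ n ]
      fixed = iter-injective {iter f (j ∸ i) (+ 1)} {+ 1} i cancelled

  exponent-injective : ∀ {i j} → iter f i (+ 1) ≈ iter f j (+ 1) [ n ] → + i ≈ + j [ m ]
  exponent-injective {i} {j} e = [ (λ i≤j → exponent-≤ i≤j e)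
                                 , (λ j≤i → ≈-sym (exponent-≤ j≤i (≈-sym e))) ]′ (ℕₚ.≤-total i j)

  -- The kernel of the power function

  K : ℤ → Set
  K a = ∀ b → f (a + b) ≈ f a + f b [ n ]

  -- f((a + b) + 1) and f(a + (b + 1)) both expand to f(a + b) plus an iterate of 1; comparing the
  -- iterates compares their exponents.
  π-σ : ∀ a b → + π (a + b) ≈ + σ (π a) b [ m ]
  π-σ a b = exponent-injective (+-cancelˡ (f (a + b)) (begin
    f (a + b) + iter f (π (a + b)) (+ 1)               ≈⟨ skew (a + b) (+ 1) ⟨
    f (a + b + + 1)                                    ≡⟨ cong f (ℤₚ.+-assoc a b (+ 1)) ⟩
    f (a + (b + + 1))                                  ≈⟨ skew a (b + + 1) ⟩
    f a + iter f (π a) (b + + 1)                       ≈⟨ +-congˡ (f a) (iter-skew (π a) b (+ 1)) ⟩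
    f a + (iter f (π a) b + iter f (σ (π a) b) (+ 1))  ≡⟨ ℤₚ.+-assoc (f a) _ _ ⟨
    f a + iter f (π a) b + iter f (σ (π a) b) (+ 1)    ≈⟨ +-congʳ _ (skew a b) ⟨
    f (a + b) + iter f (σ (π a) b) (+ 1)               ∎))
    where open ≈-Reasoning n

  π≈1⇒K : + π a ≈ + 1 [ m ] → K a
  π≈1⇒K {a} e b = ≈-trans (skew a b) (+-congˡ (f a) (exponent-resp e b))

  K⇒π≈1 : K a → + π a ≈ + 1 [ m ]
  K⇒π≈1 {a} h = exponent-injective (+-cancelˡ (f a) (≈-trans (≈-sym (skew a (+ 1))) (h (+ 1))))

  K? : ∀ a → Dec (K a)
  K? a = map′ π≈1⇒K K⇒π≈1 (+ π a ≈? + 1 [ m ])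

  K-resp : a ≈ b [ n ] → K a → K b
  K-resp {a} {b} e h c = ≈-trans (resp (+-congʳ c (≈-sym e))) (≈-trans (h c) (+-congʳ (f c) (resp e)))

  K-0 : K (+ 0)
  K-0 b = ≈-trans (≈-reflexive (trans (cong f (ℤₚ.+-identityˡ b)) (sym (ℤₚ.+-identityˡ (f b))))) (+-congʳ (f b) (≈-sym fixes-0))

  K-+ : K a → K b → K (a + b)
  K-+ {a} {b} ha hb c = begin
    f (a + b + c)      ≡⟨ cong f (ℤₚ.+-assoc a b c) ⟩
    f (a + (b + c))    ≈⟨ ha (b + c) ⟩
    f a + f (b + c)    ≈⟨ +-congˡ (f a) (hb c) ⟩
    f a + (f b + f c)  ≡⟨ ℤₚ.+-assoc (f a) (f b) (f c) ⟨
    f a + f b + f c    ≈⟨ +-congʳ (f c) (ha b) ⟨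
    f (a + b) + f c    ∎
    where open ≈-Reasoning n

  -- The constant `c` need not be known as a value of f: x = 0 identifies it with f(a). This settles
  -- -a and a - b without computing f there.
  K-translation : (∀ x → f (a + x) ≈ c + f x [ n ]) → K a
  K-translation {a} {c} h x = ≈-trans (h x) (+-congʳ (f x) (≈-sym fa))
    where
    open ≈-Reasoning n
    fa : f a ≈ c [ n ]
    fa = begin
      f a          ≡⟨ cong f (ℤₚ.+-identityʳ a) ⟨
      f (a + + 0)  ≈⟨ h (+ 0) ⟩
      c + f (+ 0)  ≈⟨ +-congˡ c fixes-0 ⟩
      c + + 0      ≡⟨ ℤₚ.+-identityʳ c ⟩
      c            ∎

  K-neg : K a → K (- a)
  K-neg {a} h = K-translation {c = - f a} λ x →
    combine₁ (- + 1) (shape (f a) (f x) (f (- a + x)))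
      (≈-trans (≈-reflexive (cong f (cancel a x))) (h (- a + x)))
    where
    shape : ∀ p q r → r - (- p + q) ≡ - + 1 * (q - (p + r))
    shape = solve-∀
    cancel : ∀ a x → x ≡ a + (- a + x)
    cancel = solve-∀

  K-*ℕ : ∀ k → K a → K (+ k * a)
  K-*ℕ {a} zero    h = subst K (sym (ℤₚ.*-zeroˡ a)) K-0
  K-*ℕ {a} (suc k) h = subst K (shape (+ k) a) (K-+ h (K-*ℕ k h))
    where
    shape : ∀ k a → a + k * a ≡ (+ 1 + k) * a
    shape = solve-∀

  K-* : ∀ k → K a → K (k * a)
  K-*     (+ k)    h = K-*ℕ k h
  K-* {a} -[1+ k ] h = subst K (ℤₚ.neg-distribˡ-* (+ suc k) a) (K-neg (K-*ℕ (suc k) h))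

  abstract
    kernel : LeastPeriod (λ j → K (+ j))
    kernel = leastPeriod (K? ∘ +_) cancel n (ℕ.>-nonZero⁻¹ n) (K-resp (≈-sym (∣⇒≈ ℕ∣.∣-refl)) K-0)
      where
      shape : ∀ i j → - i + (i + j) ≡ j
      shape = solve-∀
      cancel : ∀ i j → K (+ (i ℕ.+ j)) → K (+ i) → K (+ j)
      cancel i j hij hi = subst K (trans (cong (λ z → - + i + z) (pos-+ i j)) (shape (+ i) (+ j))) (K-+ (K-neg hi) hij)

  open LeastPeriod kernel public
    renaming (period to r; positive to r≥1; holds to r∈K; least to r-least)

  instance
    r-nonZero : NonZero r
    r-nonZero = ℕ.>-nonZero r≥1

  r∣n : r ∣ n
  r∣n = r-least n (K-resp (≈-sym (∣⇒≈ ℕ∣.∣-refl)) K-0)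

  ≈0⇒K : a ≈ + 0 [ r ] → K a
  ≈0⇒K {a} (witness q e) = subst K (sym (trans (sym (ℤₚ.+-identityʳ a)) e)) (K-* q r∈K)

  K⇒≈0 : K a → a ≈ + 0 [ r ]
  K⇒≈0 {a} h = ≈-trans (≈-residue a r) (∣⇒≈ (r-least (a %ℕ r) residue∈K))
    where
    shape : ∀ x q r → (x + q * r) + - q * r ≡ x
    shape = solve-∀
    residue≡ : a + - (a /ℕ r) * + r ≡ + (a %ℕ r)
    residue≡ = trans (cong (λ x → x + - (a /ℕ r) * + r) (a≡a%ℕn+[a/ℕn]*n a r)) (shape (+ (a %ℕ r)) (a /ℕ r) (+ r))
    residue∈K : K (+ (a %ℕ r))
    residue∈K = subst K residue≡ (K-+ h (K-* (- (a /ℕ r)) r∈K))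

  K-difference : a ≈ b [ r ] → K (a - b)
  K-difference {a} {b} = ≈0⇒K ∘ combine₁ (+ 1) (shape a b)
    where
    shape : ∀ a b → (a - b) - + 0 ≡ + 1 * (a - b)
    shape = solve-∀

  split : ∀ a b → a ≡ (a - b) + b
  split = solve-∀

  -- Equal exponents give f(a + y) - f(a) ≡ f(b + y) - f(b) for every y. With y = x - b, translating
  -- x by a - b changes f(x) by a constant.
  π-injective : + π a ≈ + π b [ m ] → a ≈ b [ r ]
  π-injective {a} {b} e = combine₁ (+ 1) (shape a b) (K⇒≈0 (K-translation {a - b} {f a - f b} λ x →
    combine₂ (+ 1) (- + 1) (shape₂ (f ((a - b) + x)) (f a) (f b) (f x) (iter f (π a) (- b + x)))
      (≈-trans (≈-reflexive (cong f (shape₃ a b x))) (skew a (- b + x)))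
      (≈-trans (≈-trans (≈-reflexive (cong f (shape₄ b x))) (skew b (- b + x)))
        (+-congˡ (f b) (exponent-resp (≈-sym e) (- b + x))))))
    where
    shape : ∀ a b → a - b ≡ + 1 * ((a - b) - + 0)
    shape = solve-∀
    shape₂ : ∀ y a b x z → y - ((a - b) + x) ≡ + 1 * (y - (a + z)) + - + 1 * (x - (b + z))
    shape₂ = solve-∀
    shape₃ : ∀ a b x → (a - b) + x ≡ a + (- b + x)
    shape₃ = solve-∀
    shape₄ : ∀ b x → x ≡ b + (- b + x)
    shape₄ = solve-∀

  π-resp : a ≈ b [ r ] → + π a ≈ + π b [ m ]
  π-resp {a} {b} e = ≈-trans (≈-reflexive (cong (λ z → + π z) (split a b)))
    (≈-trans (π-σ (a - b) b) (exponent-injective (+-cancelˡ (f (a - b) + f b) (begin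
      f (a - b) + f b + iter f (σ (π (a - b)) b) (+ 1)
        ≈⟨ +-congˡ (f (a - b) + f b) (exponent-resp (≈-sym (π-σ (a - b) b)) (+ 1)) ⟩
      f (a - b) + f b + iter f (π (a - b + b)) (+ 1)     ≈⟨ +-congʳ _ (h b) ⟨
      f (a - b + b) + iter f (π (a - b + b)) (+ 1)       ≈⟨ skew (a - b + b) (+ 1) ⟨
      f (a - b + b + + 1)                                ≡⟨ cong f (ℤₚ.+-assoc (a - b) b (+ 1)) ⟩
      f (a - b + (b + + 1))                              ≈⟨ h (b + + 1) ⟩
      f (a - b) + f (b + + 1)                            ≈⟨ +-congˡ (f (a - b)) (skew b (+ 1)) ⟩
      f (a - b) + (f b + iter f (π b) (+ 1))             ≡⟨ ℤₚ.+-assoc (f (a - b)) (f b) _ ⟨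
      f (a - b) + f b + iter f (π b) (+ 1)               ∎))))
    where
    open ≈-Reasoning n
    h = K-difference e

  -- Expanding f(a + b) from a involves no exponent, expanding it from b involves π(b); both must
  -- agree.
  π-fixes-K : ∀ b → K a → iter f (π b) a ≈ f a [ n ]
  π-fixes-K {a} b h = +-cancelˡ (f b) (begin
    f b + iter f (π b) a  ≈⟨ skew b a ⟨
    f (b + a)             ≡⟨ cong f (ℤₚ.+-comm b a) ⟩
    f (a + b)             ≈⟨ h b ⟩
    f a + f b             ≡⟨ ℤₚ.+-comm (f a) (f b) ⟩
    f b + f a             ∎)
    where open ≈-Reasoning n

  iter-comm : ∀ i x → iter f i (f x) ≡ f (iter f i x)
  iter-comm zero    x = refl
  iter-comm (suc i) x = cong f (iter-comm i x)

  surjective : ∀ b → ∃[ c ] f c ≈ b [ n ]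
  surjective b = iter f (ℕ.pred m) b , subst (λ k → iter f k b ≈ b [ n ]) (sym (ℕₚ.suc-pred m)) (f^m b)

  -- With b = f(c), the power of f attached to f(c) commutes with f and so can act on a itself,
  -- where `π-fixes-K` turns it into a single f.
  K-f : K a → K (f a)
  K-f {a} h b = let c , fc≈b = surjective b in begin
    f (f a + b)                        ≈⟨ resp (+-congˡ (f a) (≈-sym fc≈b)) ⟩
    f (f a + f c)                      ≡⟨ cong f (ℤₚ.+-comm (f a) (f c)) ⟩
    f (f c + f a)                      ≈⟨ skew (f c) (f a) ⟩
    f (f c) + iter f (π (f c)) (f a)   ≡⟨ cong (λ z → f (f c) + z) (iter-comm (π (f c)) a) ⟩
    f (f c) + f (iter f (π (f c)) a)   ≈⟨ +-congˡ (f (f c)) (resp (π-fixes-K (f c) h)) ⟩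
    f (f c) + f (f a)                  ≈⟨ +-congʳ (f (f a)) (resp fc≈b) ⟩
    f b + f (f a)                      ≡⟨ ℤₚ.+-comm (f b) (f (f a)) ⟩
    f (f a) + f b                      ∎
    where open ≈-Reasoning n

  K-iter : ∀ i → K a → K (iter f i a)
  K-iter zero    h = h
  K-iter (suc i) h = K-f (K-iter i h)

  iter-K : ∀ i → K a → ∀ b → iter f i (a + b) ≈ iter f i a + iter f i b [ n ]
  iter-K zero    h b = ≈-refl
  iter-K (suc i) h b = ≈-trans (resp (iter-K i h b)) (K-iter i h _)

  iter-K-*ℕ : ∀ i k → K a → iter f i (+ k * a) ≈ + k * iter f i a [ n ]
  iter-K-*ℕ {a} i zero h = ≈-trans (≈-reflexive (cong (iter f i) (ℤₚ.*-zeroˡ a)))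
    (≈-trans (iter-0 i) (≈-reflexive (sym (ℤₚ.*-zeroˡ (iter f i a)))))
  iter-K-*ℕ {a} i (suc k) h = begin
    iter f i (+ suc k * a)           ≡⟨ cong (iter f i) (shape (+ k) a) ⟨
    iter f i (a + + k * a)           ≈⟨ iter-K i h _ ⟩
    iter f i a + iter f i (+ k * a)  ≈⟨ +-congˡ (iter f i a) (iter-K-*ℕ i k h) ⟩
    iter f i a + + k * iter f i a    ≡⟨ shape (+ k) (iter f i a) ⟩
    + suc k * iter f i a             ∎
    where
    open ≈-Reasoning n
    shape : ∀ k a → a + k * a ≡ (+ 1 + k) * a
    shape = solve-∀

  iter-K-* : ∀ i y → K a → iter f i (y * a) ≈ y * iter f i a [ n ]
  iter-K-* {a} i y h = begin
    iter f i (y * a)             ≈⟨ iter-resp i (*-congʳ a (≈-residue y n)) ⟩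
    iter f i (+ (y %ℕ n) * a)    ≈⟨ iter-K-*ℕ i (y %ℕ n) h ⟩
    + (y %ℕ n) * iter f i a      ≈⟨ *-congʳ (iter f i a) (≈-residue y n) ⟨
    y * iter f i a               ∎
    where open ≈-Reasoning n

  -- Well defined because arguments congruent modulo `r` differ by a kernel element, and `K-f` keeps
  -- the images of such differences in the kernel.
  quotient : Skew r f
  quotient = record
    { nonZero = r-nonZero
    ; resp    = resp-r
    ; fixes-0 = weaken r∣n fixes-0
    ; π       = π
    ; π≥1     = π≥1
    ; skew    = λ a b → weaken r∣n (skew a b)
    ; N       = N
    ; N≥1     = N≥1
    ; f^N     = λ a → weaken r∣n (f^N a)
    }
    where
    resp-r : a ≈ b [ r ] → f a ≈ f b [ r ]
    resp-r {a} {b} e = begin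
      f a              ≡⟨ cong f (split a b) ⟩
      f (a - b + b)    ≈⟨ weaken r∣n (K-difference e b) ⟩
      f (a - b) + f b  ≈⟨ +-congʳ (f b) (K⇒≈0 (K-f (K-difference e))) ⟩
      + 0 + f b        ≡⟨ ℤₚ.+-identityˡ (f b) ⟩
      f b              ∎
      where open ≈-Reasoning r

-- The parameters r, r′, k, k′, q, m, D

module Index {n : ℕ} {f : ℤ → ℤ} (S : Skew n f) where
  open SkewTheory S

  -- 0 and the `m` iterates of 1 are pairwise incongruent: f fixes 0, and 1 ≢ 0 because n ≥ 2.
  order<modulus : 2 ≤ n → m < n
  order<modulus 2≤n = pigeonhole (suc m) n g distinct
    where
    g : ℕ → ℤ
    g zero    = + 0
    g (suc i) = iter f i (+ 1)

    distinct : ∀ i j → i < j → j < suc m → ¬ g i ≈ g j [ n ]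
    distinct zero (suc j) _ _ e = contradiction
      (small (ℕₚ.<-trans (s≤s z≤n) 2≤n) 2≤n (iter-injective j (≈-trans (iter-0 j) e))) λ ()
    distinct (suc i) (suc j) (s≤s i<j) (s≤s j<m) e =
      ℕₚ.<⇒≢ i<j (small (ℕₚ.<-trans i<j j<m) j<m (exponent-injective e))

  index≤order : r ≤ m
  index≤order = pigeonhole r m (λ i → + π (+ i)) λ i j i<j j<r e →
    ℕₚ.<⇒≢ i<j (small (ℕₚ.<-trans i<j j<r) j<r (π-injective e))

  index<modulus : 2 ≤ n → r < n
  index<modulus 2≤n = ℕₚ.≤-<-trans index≤order (order<modulus 2≤n)

  iter-cancel : ∀ i j {a} → iter f (i ℕ.+ j) a ≈ a [ n ] → iter f i a ≈ a [ n ] → iter f j a ≈ a [ n ]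
  iter-cancel i j {a} hij hi = iter-injective i (begin
    iter f i (iter f j a)  ≡⟨ iter-+ f i j a ⟨
    iter f (i ℕ.+ j) a     ≈⟨ hij ⟩
    a                      ≈⟨ hi ⟨
    iter f i a             ∎)
    where open ≈-Reasoning n

parity : ∀ a → a ≈ + 0 [ 2 ] ⊎ a ≈ + 1 [ 2 ]
parity a = cases (a %ℕ 2) (n%ℕd<d a 2) (≈-residue a 2)
  where
  cases : ∀ x → x < 2 → a ≈ + x [ 2 ] → a ≈ + 0 [ 2 ] ⊎ a ≈ + 1 [ 2 ]
  cases 0 _ e = inj₁ e
  cases 1 _ e = inj₂ e
  cases (suc (suc _)) (s≤s (s≤s ())) _

module NonSmooth {n : ℕ} {f : ℤ → ℤ} (S : Skew n f)
  (quotient-smooth : f (+ 1) ≈ + 1 [ SkewTheory.r (SkewTheory.quotient S) ])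
  (non-smooth : ¬ f (+ 1) ≈ + 1 [ SkewTheory.r S ])
  where
  open SkewTheory S public
  module Q = SkewTheory quotient
  q r′ k k′ : ℕ
  q  = Q.m
  r′ = Q.r
  k  = ℕ∣.quotient r∣n
  k′ = ℕ∣.quotient Q.r∣n

  n≡kr : n ≡ k ℕ.* r
  n≡kr = ℕ∣._∣_.equality r∣n

  r≡k′r′ : r ≡ k′ ℕ.* r′
  r≡k′r′ = ℕ∣._∣_.equality Q.r∣n

  instance
    k-nonZero : NonZero k
    k-nonZero = ℕ.≢-nonZero λ k≡0 → ℕ.≢-nonZero⁻¹ n (trans n≡kr (cong (ℕ._* r) k≡0))

    k′-nonZero : NonZero k′
    k′-nonZero = ℕ.≢-nonZero λ k′≡0 → ℕ.≢-nonZero⁻¹ r (trans r≡k′r′ (cong (ℕ._* r′) k′≡0))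

  smooth-iter : ∀ i a → iter f i a ≈ a [ r′ ]
  smooth-iter zero    a = ≈-refl
  smooth-iter (suc i) a = ≈-trans (SkewTheory.fixes-1⇒Fixes Q.quotient 1 quotient-smooth _) (smooth-iter i a)

  abstract
    -- Two tests suffice: 1 controls ℤ/r, and r generates the kernel, on which f is additive.
    D-properties : LeastPeriod (λ j → iter f j (+ 1) ≈ + 1 [ r ] × iter f j (+ r) ≈ + r [ n ])
    D-properties = leastPeriod (λ j → (iter f j (+ 1) ≈? + 1 [ r ]) ×-dec (iter f j (+ r) ≈? + r [ n ]))
      (λ i j (h₁ , h₂) (h₃ , h₄) → Index.iter-cancel quotient i j h₁ h₃ , Index.iter-cancel S i j h₂ h₄)
      m m≥1 (weaken r∣n (f^m (+ 1)) , f^m (+ r))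

  open LeastPeriod D-properties renaming (period to D; positive to D≥1; holds to D-holds; least to D-least) public

  instance
    D-nonZero : NonZero D
    D-nonZero = ℕ.>-nonZero D≥1

  D∣m : D ∣ m
  D∣m = D-least m (weaken r∣n (f^m (+ 1)) , f^m (+ r))

  s′ : ℕ
  s′ = ℕ∣.quotient D∣m

  m≡s′D : m ≡ s′ ℕ.* D
  m≡s′D = ℕ∣._∣_.equality D∣m

  instance
    s′-nonZero : NonZero s′
    s′-nonZero = ℕ.≢-nonZero λ s′≡0 → ℕ.≢-nonZero⁻¹ m (trans m≡s′D (cong (ℕ._* D) s′≡0))

  D-fixes-mod-r : ∀ a → iter f D a ≈ a [ r ]
  D-fixes-mod-r = Q.fixes-1⇒Fixes D (proj₁ D-holds)

  D-fixes-K : ∀ a → K a → iter f D a ≈ a [ n ]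
  D-fixes-K a h = begin
    iter f D a           ≡⟨ cong (iter f D) a≡ ⟩
    iter f D (y * + r)   ≈⟨ iter-K-* D y r∈K ⟩
    y * iter f D (+ r)   ≈⟨ *-congˡ y (proj₂ D-holds) ⟩
    y * + r              ≡⟨ a≡ ⟨
    a                    ∎
    where
    open ≈-Reasoning n
    y : ℤ
    y = _≈_[_].quotient (K⇒≈0 h)
    a≡ : a ≡ y * + r
    a≡ = trans (sym (ℤₚ.+-identityʳ a)) (_≈_[_].equality (K⇒≈0 h))

  displacement : ℤ → ℤ
  displacement a = iter f D a - a

  displacement∈K : ∀ a → K (displacement a)
  displacement∈K a = K-difference (D-fixes-mod-r a)

  -- f^D moves a by a kernel element and fixes that element, so every application adds the same
  -- displacement.
  D-power : ∀ j a → iter f (j ℕ.* D) a ≈ + j * displacement a + a [ n ]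
  D-power zero    a = ≈-reflexive (shape (displacement a) a)
    where
    shape : ∀ w a → a ≡ + 0 * w + a
    shape = solve-∀
  D-power (suc j) a = begin
    iter f (D ℕ.+ j ℕ.* D) a                     ≡⟨ iter-+ f D (j ℕ.* D) a ⟩
    iter f D (iter f (j ℕ.* D) a)                ≈⟨ iter-resp D (D-power j a) ⟩
    iter f D (+ j * displacement a + a)          ≈⟨ iter-K D (K-* (+ j) (displacement∈K a)) a ⟩
    iter f D (+ j * displacement a) + iter f D a
      ≈⟨ +-congʳ (iter f D a) (D-fixes-K (+ j * displacement a) (K-* (+ j) (displacement∈K a))) ⟩
    + j * displacement a + iter f D a            ≡⟨ shape (+ j) (iter f D a) a ⟩
    + suc j * displacement a + a                 ∎
    where
    open ≈-Reasoning n
    shape : ∀ j x a → j * (x - a) + x ≡ (+ 1 + j) * (x - a) + a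
    shape = solve-∀

  -- The displacement of 1 under f^D is a multiple of r, so k such displacements add up to a
  -- multiple of kr = n.
  m∣kD : m ∣ k ℕ.* D
  m∣kD = m-least (k ℕ.* D) (fixes-1⇒Fixes (k ℕ.* D) (begin
    iter f (k ℕ.* D) (+ 1)  ≈⟨ D-power k (+ 1) ⟩
    + k * w + + 1           ≈⟨ +-congʳ (+ 1) kw≈0 ⟩
    + 0 + + 1               ∎))
    where
    open ≈-Reasoning n
    w : ℤ
    w = displacement (+ 1)

    kw≈0 : + k * w ≈ + 0 [ n ]
    kw≈0 = subst₂ (λ x y → x ≈ + 0 [ y ]) (ℤₚ.*-comm w (+ k)) (trans (ℕₚ.*-comm r k) (sym n≡kr))
      (scale k (K⇒≈0 (displacement∈K (+ 1))))

  s′∣k : s′ ∣ k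
  s′∣k = ℕ∣.*-cancelʳ-∣ D (subst (_∣ k ℕ.* D) m≡s′D m∣kD)

  -- The power π(b) of f agrees with f on ℤ/r because π(b) ≡ 1 (mod q), and on the kernel by
  -- `π-fixes-K`. Cancelling one f leaves the exponent π(b) - 1.
  D∣π∸1 : ∀ {b} → Q.K b → D ∣ π b ∸ 1
  D∣π∸1 {b} h = D-least (π b ∸ 1)
    ( Q.injective (subst (λ i → iter f i (+ 1) ≈ f (+ 1) [ r ]) π≡ (Q.exponent-resp (Q.K⇒π≈1 h) (+ 1)))
    , injective (subst (λ i → iter f i (+ r) ≈ f (+ r) [ n ]) π≡ (π-fixes-K b r∈K)))
    where
    π≡ : π b ≡ suc (π b ∸ 1)
    π≡ = sym (ℕₚ.m+[n∸m]≡n (π≥1 b))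

  F : ∀ {b} → Q.K b → ℕ
  F h = ℕ∣.quotient (D∣π∸1 h)

  π≡1+FD : ∀ {b} (h : Q.K b) → + π b ≡ + 1 + + F h * + D
  π≡1+FD {b} h = trans (cong +_ (trans (sym (ℕₚ.m+[n∸m]≡n (π≥1 b))) (cong suc (ℕ∣._∣_.equality (D∣π∸1 h)))))
    (cong (λ z → + 1 + z) (pos-* (F h) D))

  π≈⇒F≈ : ∀ {a b} (ha : Q.K a) (hb : Q.K b) → + π a ≈ + π b [ m ] → + F ha ≈ + F hb [ s′ ]
  π≈⇒F≈ ha hb e = unscale D (subst (λ x → + F ha * + D ≈ + F hb * + D [ x ]) m≡s′D
    (+-cancelˡ (+ 1) (subst₂ (_≈_[ m ]) (π≡1+FD ha) (π≡1+FD hb) e)))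

  F≈⇒π≈ : ∀ {a b} (ha : Q.K a) (hb : Q.K b) → + F ha ≈ + F hb [ s′ ] → + π a ≈ + π b [ m ]
  F≈⇒π≈ ha hb e = subst₂ (_≈_[ m ]) (sym (π≡1+FD ha)) (sym (π≡1+FD hb)) (+-congˡ (+ 1)
    (subst (λ x → + F ha * + D ≈ + F hb * + D [ x ]) (sym m≡s′D) (scale D e)))

  q≤k′ : q ≤ k′
  q≤k′ = pigeonhole q k′ y λ i j i<j j<q e →
    ℕₚ.<⇒≢ i<j (small (ℕₚ.<-trans i<j j<q) j<q (Q.exponent-injective (recover i j e)))
    where
    y : ℕ → ℤ
    y i = _≈_[_].quotient (smooth-iter i (+ 1))

    iter≡ : ∀ i → iter f i (+ 1) ≡ + 1 + y i * + r′
    iter≡ i = trans (shape (iter f i (+ 1))) (cong (λ z → + 1 + z) (_≈_[_].equality (smooth-iter i (+ 1))))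
      where
      shape : ∀ x → x ≡ + 1 + (x - + 1)
      shape = solve-∀

    recover : ∀ i j → y i ≈ y j [ k′ ] → iter f i (+ 1) ≈ iter f j (+ 1) [ r ]
    recover i j e = subst₂ (_≈_[ r ]) (sym (iter≡ i)) (sym (iter≡ j)) (+-congˡ (+ 1)
      (subst (λ x → y i * + r′ ≈ y j * + r′ [ x ]) (sym r≡k′r′) (scale r′ e)))

  multiple∈K : ∀ i → Q.K (+ i * + r′)
  multiple∈K i = Q.K-* (+ i) Q.r∈K

  k′≤s′ : k′ ≤ s′
  k′≤s′ = pigeonhole k′ s′ (λ i → + F (multiple∈K i)) λ i j i<j j<k′ e →
    ℕₚ.<⇒≢ i<j (small (ℕₚ.<-trans i<j j<k′) j<k′ (unscale r′ (subst (λ x → + i * + r′ ≈ + j * + r′ [ x ]) r≡k′r′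
      (π-injective (F≈⇒π≈ (multiple∈K i) (multiple∈K j) e)))))

  q≢1 : q ≢ 1
  q≢1 q≡1 = non-smooth (subst (λ i → iter f i (+ 1) ≈ + 1 [ r ]) q≡1 (Q.f^m (+ 1)))

  -- Were the order 2 and π(1) even, 0 = f(1 − 1) = f(1) − 1 would follow.
  q≡2⇒r′≡1 : q ≡ 2 → r′ ≡ 1
  q≡2⇒r′≡1 q≡2 = ℕ∣.∣1⇒≡1 (Q.r-least 1 (Q.π≈1⇒K odd))
    where
    open ≈-Reasoning r
    shape : ∀ x → x ≡ (x + - + 1) + + 1
    shape = solve-∀

    even⇒smooth : + π (+ 1) ≈ + 0 [ q ] → f (+ 1) ≈ + 1 [ r ]
    even⇒smooth e = begin
      f (+ 1)                                        ≡⟨ shape (f (+ 1)) ⟩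
      (f (+ 1) + - + 1) + + 1                        ≈⟨ +-congʳ (+ 1) (+-congˡ (f (+ 1)) (Q.exponent-resp e (- + 1))) ⟨
      (f (+ 1) + iter f (π (+ 1)) (- + 1)) + + 1     ≈⟨ +-congʳ (+ 1) (Q.skew (+ 1) (- + 1)) ⟨
      f (+ 0) + + 1                                  ≈⟨ +-congʳ (+ 1) Q.fixes-0 ⟩
      + 0 + + 1                                      ∎

    odd : + π (+ 1) ≈ + 1 [ q ]
    odd = subst (+ π (+ 1) ≈ + 1 [_]) (sym q≡2) ([ (λ e → contradiction (even⇒smooth (subst (+ π (+ 1) ≈ + 0 [_]) (sym q≡2) e)) non-smooth) , id ]′ (parity (+ π (+ 1))))

  r≥2 : 2 ≤ r
  r≥2 = ℕₚ.≤∧≢⇒< r≥1 λ 1≡r → non-smooth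
    (subst (f (+ 1) ≈ + 1 [_]) 1≡r (witness (f (+ 1) - + 1) (sym (ℤₚ.*-identityʳ _))))

  q≥2 : 2 ≤ q
  q≥2 = ℕₚ.≤∧≢⇒< Q.m≥1 (q≢1 ∘ sym)

  -- If q ≥ 3, then q ≤ k′ suffices. If q = 2, then r′ = 1 and k′ = r, which exceeds q because the
  -- order is smaller than the modulus.
  3≤k′ : 3 ≤ k′
  3≤k′ = [ (λ 2<q → ℕₚ.≤-trans 2<q q≤k′)
         , (λ 2≡q → ℕₚ.≤-trans (s≤s q≥2) (subst (q <_)
             (trans r≡k′r′ (trans (cong (k′ ℕ.*_) (q≡2⇒r′≡1 (sym 2≡q))) (ℕₚ.*-identityʳ k′)))
             (Index.order<modulus quotient r≥2))) ]′ (ℕₚ.m≤n⇒m<n∨m≡n q≥2)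

  k′≤k : k′ ≤ k
  k′≤k = ℕₚ.≤-trans k′≤s′ (∣⇒≤ s′∣k)

-- Arithmetic of 8p

factors-of-8 : ∀ x y z → 3 ≤ y → x ℕ.* (y ℕ.* z) ∣ 8 →
  (y ≡ 4 × z ≡ 1 × x ≡ 1) ⊎ (y ≡ 4 × z ≡ 1 × x ≡ 2) ⊎ (y ≡ 4 × z ≡ 2 × x ≡ 1) ⊎ (y ≡ 8 × z ≡ 1 × x ≡ 1)
factors-of-8 x y z 3≤y d = search (bound x∣8) (bound y∣8) (bound z∣8) 3≤y d
  where
  x∣8 : x ∣ 8
  x∣8 = ℕ∣.∣-trans (ℕ∣.m∣m*n (y ℕ.* z)) d
  yz∣8 : y ℕ.* z ∣ 8
  yz∣8 = ℕ∣.∣-trans (ℕ∣.n∣m*n x) d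
  y∣8 : y ∣ 8
  y∣8 = ℕ∣.∣-trans (ℕ∣.m∣m*n z) yz∣8
  z∣8 : z ∣ 8
  z∣8 = ℕ∣.∣-trans (ℕ∣.n∣m*n y) yz∣8
  bound : ∀ {u} → u ∣ 8 → u < 9
  bound u∣8 = s≤s (∣⇒≤ u∣8)
  search : ∀ {x} → x < 9 → ∀ {y} → y < 9 → ∀ {z} → z < 9 → 3 ≤ y → x ℕ.* (y ℕ.* z) ∣ 8 →
    (y ≡ 4 × z ≡ 1 × x ≡ 1) ⊎ (y ≡ 4 × z ≡ 1 × x ≡ 2) ⊎ (y ≡ 4 × z ≡ 2 × x ≡ 1) ⊎ (y ≡ 8 × z ≡ 1 × x ≡ 1)
  search = from-yes (allUpTo? (λ x → allUpTo? (λ y → allUpTo? (λ z →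
    (3 ℕ.≤? y) →-dec ((x ℕ.* (y ℕ.* z) ℕ∣.∣? 8) →-dec
      (((y ℕ.≟ 4) ×-dec ((z ℕ.≟ 1) ×-dec (x ℕ.≟ 1))) ⊎-dec (((y ℕ.≟ 4) ×-dec ((z ℕ.≟ 1) ×-dec (x ℕ.≟ 2)))
        ⊎-dec (((y ℕ.≟ 4) ×-dec ((z ℕ.≟ 2) ×-dec (x ℕ.≟ 1))) ⊎-dec ((y ℕ.≟ 8) ×-dec ((z ℕ.≟ 1) ×-dec (x ℕ.≟ 1)))))))) 9) 9) 9)

-- For r′ = 1 the quotient is an automorphism of ℤ/r, hence the names. The pattern k = 2p, k′ = 4
-- splits: p = 2 gives k = 4 and n = 16.
data Obstruction (p k k′ : ℕ) : ℕ → Set where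
  automorphism-coprime : Coprime k k′ → Obstruction p k k′ 1
  automorphism-2p      : k′ ≡ 4 → k ≡ 2 ℕ.* p → ∃[ h ] p ≡ 1 ℕ.+ 2 ℕ.* h → Obstruction p k k′ 1
  automorphism-16      : k′ ≡ 4 → k ≡ 4 → Obstruction p k k′ 1
  index-2              : Coprime k k′ → k′ ≡ 3 ⊎ k′ ≡ 4 → Obstruction p k k′ 2

prime-odd : ∀ {p} → Prime p → p ≢ 2 → ∃[ h ] p ≡ 1 ℕ.+ 2 ℕ.* h
prime-odd {p} pp p≢2 = cases (p % 2) (m%n<n p 2) (m≡m%n+[m/n]*n p 2)
  where
  cases : ∀ x → x < 2 → p ≡ x ℕ.+ p ℕ./ 2 ℕ.* 2 → ∃[ h ] p ≡ 1 ℕ.+ 2 ℕ.* h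
  cases 0 _ e = contradiction (sym ([ (λ ()) , id ]′ (prime⇒irreducible pp (divides (p ℕ./ 2) e)))) p≢2
  cases 1 _ e = p ℕ./ 2 , trans e (cong suc (ℕₚ.*-comm (p ℕ./ 2) 2))
  cases (suc (suc _)) (s≤s (s≤s ())) _

-- p divides one of the four factors. If it divides j or r′, then kk′ ≥ 9 divides 8. Otherwise
-- cancelling p leaves a divisor of 8 to be factored, and k′ ≤ k bounds p from below when p ∣ k and
-- from above when p ∣ k′.
obstruction : ∀ {p} → Prime p → ∀ j k k′ r′ → 8 ℕ.* p ≡ j ℕ.* (k ℕ.* (k′ ℕ.* r′)) →
  3 ≤ k′ → k′ ≤ k → Obstruction p k k′ r′
obstruction {p} pp j k k′ r′ e 3≤k′ k′≤k =
  [ p∣j , (λ d → [ p∣k , (λ d → [ p∣k′ , p∣r′ ]′ (euclidsLemma k′ r′ pp d)) ]′ (euclidsLemma k (k′ ℕ.* r′) pp d)) ]′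
    (euclidsLemma j (k ℕ.* (k′ ℕ.* r′)) pp (divides 8 (sym e)))
  where
  instance
    p-nonZero : NonZero p
    p-nonZero = prime⇒nonZero pp

  9≤kk′ : 9 ≤ k ℕ.* k′
  9≤kk′ = ℕₚ.*-mono-≤ (ℕₚ.≤-trans 3≤k′ k′≤k) 3≤k′

  too-large : k ℕ.* k′ ∣ 8 → Obstruction p k k′ r′
  too-large d = contradiction (ℕₚ.≤-trans 9≤kk′ (∣⇒≤ d)) (ℕₚ.<⇒≱ (from-yes (8 ℕ.<? 9)))

  p∣j : p ∣ j → Obstruction p k k′ r′
  p∣j (divides x refl) = too-large (divides (x ℕ.* r′) (ℕₚ.*-cancelʳ-≡ 8 _ p (trans e (shape x p k k′ r′))))
    where
    shape : ∀ x p k k′ r′ → x ℕ.* p ℕ.* (k ℕ.* (k′ ℕ.* r′)) ≡ x ℕ.* r′ ℕ.* (k ℕ.* k′) ℕ.* p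
    shape = ℕ-solve-∀

  p∣r′ : p ∣ r′ → Obstruction p k k′ r′
  p∣r′ (divides x refl) = too-large (divides (x ℕ.* j) (ℕₚ.*-cancelʳ-≡ 8 _ p (trans e (shape x p j k k′))))
    where
    shape : ∀ x p j k k′ → j ℕ.* (k ℕ.* (k′ ℕ.* (x ℕ.* p))) ≡ x ℕ.* j ℕ.* (k ℕ.* k′) ℕ.* p
    shape = ℕ-solve-∀

  coprime-p : ∀ {u} .{{_ : NonZero u}} → ¬ Prime u → u ≤ p → Coprime p u
  coprime-p ¬pu u≤p = prime⇒coprime pp (ℕₚ.≤∧≢⇒< u≤p λ { refl → ¬pu pp })

  ¬prime : ∀ {u} → False (prime? u) → ¬ Prime u
  ¬prime = toWitnessFalse

  p∣k : p ∣ k → Obstruction p k k′ r′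
  p∣k (divides x refl) = cases (factors-of-8 x k′ r′ 3≤k′ (divides j (ℕₚ.*-cancelʳ-≡ 8 _ p (trans e (shape x p j k′ r′)))))
    where
    shape : ∀ x p j k′ r′ → j ℕ.* (x ℕ.* p ℕ.* (k′ ℕ.* r′)) ≡ j ℕ.* (x ℕ.* (k′ ℕ.* r′)) ℕ.* p
    shape = ℕ-solve-∀
    cases : _ → Obstruction p (x ℕ.* p) k′ r′
    cases (inj₁ (refl , refl , refl)) = automorphism-coprime (subst (λ y → Coprime y 4) (sym (ℕₚ.*-identityˡ p))
      (coprime-p (¬prime _) (subst (4 ≤_) (ℕₚ.*-identityˡ p) k′≤k)))
    cases (inj₂ (inj₁ (refl , refl , refl))) = even-or-odd (p ℕ.≟ 2)
      where
      even-or-odd : Dec (p ≡ 2) → Obstruction p (2 ℕ.* p) 4 1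
      even-or-odd (yes p≡2) = automorphism-16 refl (cong (2 ℕ.*_) p≡2)
      even-or-odd (no p≢2) = automorphism-2p refl refl (prime-odd pp p≢2)
    cases (inj₂ (inj₂ (inj₁ (refl , refl , refl)))) = index-2 (subst (λ y → Coprime y 4) (sym (ℕₚ.*-identityˡ p))
      (coprime-p (¬prime _) (subst (4 ≤_) (ℕₚ.*-identityˡ p) k′≤k))) (inj₂ refl)
    cases (inj₂ (inj₂ (inj₂ (refl , refl , refl)))) = automorphism-coprime (subst (λ y → Coprime y 8) (sym (ℕₚ.*-identityˡ p))
      (coprime-p (¬prime _) (subst (8 ≤_) (ℕₚ.*-identityˡ p) k′≤k)))

  p∣k′ : p ∣ k′ → Obstruction p k k′ r′
  p∣k′ (divides x refl) = cases (factors-of-8 x k r′ (ℕₚ.≤-trans 3≤k′ k′≤k)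
      (divides j (ℕₚ.*-cancelʳ-≡ 8 _ p (trans e (shape x p j k r′)))))
    where
    shape : ∀ x p j k r′ → j ℕ.* (k ℕ.* (x ℕ.* p ℕ.* r′)) ≡ j ℕ.* (x ℕ.* (k ℕ.* r′)) ℕ.* p
    shape = ℕ-solve-∀

    odd-≤8 : ∀ u → u < 9 → 3 ≤ u → Prime u → Coprime 8 u
    odd-≤8 u u<9 = from-yes (allUpTo? (λ u → (3 ℕ.≤? u) →-dec (prime? u →-dec coprime? 8 u)) 9) u<9

    odd-≤4 : ∀ u → u < 5 → 3 ≤ u → Prime u → u ≡ 3
    odd-≤4 u u<5 = from-yes (allUpTo? (λ u → (3 ℕ.≤? u) →-dec (prime? u →-dec u ℕ.≟ 3)) 5) u<5

    k′≡p : 1 ℕ.* p ≡ p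
    k′≡p = ℕₚ.*-identityˡ p

    cases : _ → Obstruction p k (x ℕ.* p) r′
    cases (inj₁ (refl , refl , refl)) = automorphism-coprime (subst (Coprime 4) (sym (trans k′≡p p≡3)) (from-yes (coprime? 4 3)))
      where
      p≡3 : p ≡ 3
      p≡3 = odd-≤4 p (s≤s (subst (_≤ 4) k′≡p k′≤k)) (subst (3 ≤_) k′≡p 3≤k′) pp
    cases (inj₂ (inj₁ (refl , refl , refl))) = automorphism-16 (cong (2 ℕ.*_) p≡2) refl
      where
      p≡2 : p ≡ 2
      p≡2 = ℕₚ.≤-antisym (ℕₚ.*-cancelˡ-≤ 2 k′≤k) (ℕ.nonTrivial⇒n>1 p {{prime⇒nonTrivial pp}})
    cases (inj₂ (inj₂ (inj₁ (refl , refl , refl)))) = index-2 (subst (Coprime 4) (sym (trans k′≡p p≡3)) (from-yes (coprime? 4 3)))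
        (inj₁ (trans k′≡p p≡3))
      where
      p≡3 : p ≡ 3
      p≡3 = odd-≤4 p (s≤s (subst (_≤ 4) k′≡p k′≤k)) (subst (3 ≤_) k′≡p 3≤k′) pp
    cases (inj₂ (inj₂ (inj₂ (refl , refl , refl)))) = automorphism-coprime (subst (Coprime 8) (sym k′≡p)
      (odd-≤8 p (s≤s (subst (_≤ 8) k′≡p k′≤k)) (subst (3 ≤_) k′≡p 3≤k′) pp))

-- Quotients that are automorphisms

module Affine {s : ℕ} (G t : ℤ → ℤ) (w : ℕ)
  (G-0 : G (+ 0) ≈ + 0 [ s ])
  (G-+ : ∀ a b → G (a + b) ≈ G b + G a * t b [ s ])
  (t-w+1 : t (+ w + + 1) ≈ t (+ 1) [ s ])
  where
  private
    T u g : ℤ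
    T = t (+ 1)
    u = G (+ 1)
    g = G (+ w)
  open ≈-Reasoning s

  -- Expand G(w + 2) as G(1 + (w + 1)) and as G((w + 1) + 1). As t(w + 1) and t(1) agree, the two
  -- results differ by gT - gT².
  gT≈gTT : g * T ≈ g * T * T [ s ]
  gT≈gTT = combine₂ (+ 1) (T - + 1) (shape (G (+ w + + 1)) u g T) commuted (G-+ (+ w) (+ 1))
    where
    shape : ∀ x u g T → g * T - g * T * T ≡
      + 1 * ((x + u * T) - (u + x * T)) + (T - + 1) * (x - (u + g * T))
    shape = solve-∀
    commuted : G (+ w + + 1) + u * T ≈ u + G (+ w + + 1) * T [ s ]
    commuted = begin
      G (+ w + + 1) + u * T                ≈⟨ +-congˡ (G (+ w + + 1)) (*-congˡ u t-w+1) ⟨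
      G (+ w + + 1) + u * t (+ w + + 1)    ≈⟨ G-+ (+ 1) (+ w + + 1) ⟨
      G (+ 1 + (+ w + + 1))                ≡⟨ cong G (ℤₚ.+-comm (+ 1) (+ w + + 1)) ⟩
      G (+ w + + 1 + + 1)                  ≈⟨ G-+ (+ w + + 1) (+ 1) ⟩
      u + G (+ w + + 1) * T                ∎

  -- Passing from w to w - 1 and back shows that T acts invertibly on g, with inverse t(-1). So one
  -- T can be cancelled from `gT≈gTT`.
  g≈gt₋T : g ≈ g * t (- + 1) * T [ s ]
  g≈gt₋T = combine₃ (+ 1) T (- + 1) (shape g u (G (+ w + - + 1)) (G (- + 1)) T (t (- + 1)))
    (≈-trans (≈-reflexive (cong G (w-1+1 (+ w)))) (G-+ (+ w + - + 1) (+ 1)))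
    (G-+ (+ w) (- + 1))
    (≈-trans (≈-sym G-0) (G-+ (- + 1) (+ 1)))
    where
    shape : ∀ g u y v T t₋ → g - g * t₋ * T ≡
      + 1 * (g - (u + y * T)) + T * (y - (v + g * t₋)) + - + 1 * (+ 0 - (u + v * T))
    shape = solve-∀
    w-1+1 : ∀ w → w ≡ w + - + 1 + + 1
    w-1+1 = solve-∀

  gT≈g : g * T ≈ g [ s ]
  gT≈g = combine₂ (T - + 1) (- t (- + 1)) (shape g T (t (- + 1))) g≈gt₋T gT≈gTT
    where
    shape : ∀ g T t₋ → g * T - g ≡ (T - + 1) * (g - g * t₋ * T) + - t₋ * (g * T - g * T * T)
    shape = solve-∀

  G-shift : ∀ j → G (+ w + + j) ≈ G (+ j) + g [ s ]
  G-shift zero = begin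
    G (+ w + + 0)   ≡⟨ cong G (ℤₚ.+-identityʳ (+ w)) ⟩
    g               ≡⟨ ℤₚ.+-identityˡ g ⟨
    + 0 + g         ≈⟨ +-congʳ g G-0 ⟨
    G (+ 0) + g     ∎
  G-shift (suc j) = begin
    G (+ w + (+ 1 + + j))          ≡⟨ cong G (shape₁ (+ w) (+ j)) ⟩
    G (+ w + + j + + 1)            ≈⟨ G-+ (+ w + + j) (+ 1) ⟩
    u + G (+ w + + j) * T          ≈⟨ +-congˡ u (*-congʳ T (G-shift j)) ⟩
    u + (G (+ j) + g) * T          ≡⟨ shape₂ u (G (+ j)) g T ⟩
    u + G (+ j) * T + g * T        ≈⟨ +-cong (≈-sym (G-+ (+ j) (+ 1))) gT≈g ⟩
    G (+ j + + 1) + g              ≡⟨ cong (λ z → G z + g) (ℤₚ.+-comm (+ j) (+ 1)) ⟩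
    G (+ 1 + + j) + g              ∎
    where
    shape₁ : ∀ w j → w + (+ 1 + j) ≡ w + j + + 1
    shape₁ = solve-∀
    shape₂ : ∀ u x g T → u + (x + g) * T ≡ u + x * T + g * T
    shape₂ = solve-∀

  G-multiple : ∀ j → G (+ (j ℕ.* w)) ≈ + j * g [ s ]
  G-multiple zero = ≈-trans G-0 (≈-reflexive (sym (ℤₚ.*-zeroˡ g)))
  G-multiple (suc j) = begin
    G (+ w + + (j ℕ.* w))   ≈⟨ G-shift (j ℕ.* w) ⟩
    G (+ (j ℕ.* w)) + g     ≈⟨ +-congʳ g (G-multiple j) ⟩
    + j * g + g             ≡⟨ shape (+ j) g ⟩
    + suc j * g             ∎
    where
    shape : ∀ j g → j * g + g ≡ (+ 1 + j) * g
    shape = solve-∀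

orbit-sum : (ℤ → ℤ) → (ℤ → ℤ) → ℕ → ℤ → ℤ
orbit-sum f g zero    b = + 0
orbit-sum f g (suc y) b = g (iter f y b) + orbit-sum f g y b

orbit-sum-rotate : ∀ f g y b → orbit-sum f g y (f b) + g b ≡ g (iter f y b) + orbit-sum f g y b
orbit-sum-rotate f g zero    b = ℤₚ.+-comm (+ 0) (g b)
orbit-sum-rotate f g (suc y) b = trans (ℤₚ.+-assoc (g (iter f y (f b))) (orbit-sum f g y (f b)) (g b))
  (cong₂ _+_ (cong g (iter-comm y)) (orbit-sum-rotate f g y b))
  where
  iter-comm : ∀ i → iter f i (f b) ≡ f (iter f i b)
  iter-comm zero    = refl
  iter-comm (suc i) = cong f (iter-comm i)

module Automorphism {n : ℕ} {f : ℤ → ℤ} (S : Skew n f)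
  (quotient-smooth : f (+ 1) ≈ + 1 [ SkewTheory.r (SkewTheory.quotient S) ])
  (non-smooth : ¬ f (+ 1) ≈ + 1 [ SkewTheory.r S ])
  (r′≡1 : SkewTheory.r (SkewTheory.quotient S) ≡ 1)
  where
  open NonSmooth S quotient-smooth non-smooth public

  additive-mod-r : ∀ a → Q.K a
  additive-mod-r a = Q.≈0⇒K (subst (a ≈ + 0 [_]) (sym r′≡1) (witness a (shape a)))
    where
    shape : ∀ a → a - + 0 ≡ a * + 1
    shape = solve-∀

  abstract
    G : ℤ → ℤ
    G a = + F (additive-mod-r a)

    π≡1+GD : ∀ a → + π a ≡ + 1 + G a * + D
    π≡1+GD a = π≡1+FD (additive-mod-r a)

    G-resp : a ≈ b [ r ] → G a ≈ G b [ s′ ]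
    G-resp {a} {b} e = π≈⇒F≈ (additive-mod-r a) (additive-mod-r b) (π-resp e)

    G-natural : ∀ a → ∃[ i ] G a ≡ + i
    G-natural a = F (additive-mod-r a) , refl

  π≡suc : ∀ a → π a ≡ suc (proj₁ (G-natural a) ℕ.* D)
  π≡suc a = ℤₚ.+-injective (trans (π≡1+GD a) (trans (cong (λ x → + 1 + x * + D) (proj₂ (G-natural a)))
    (cong (λ z → + 1 + z) (sym (pos-* (proj₁ (G-natural a)) D)))))

  cancel-D : ∀ x y → + 1 + x * + D ≈ + 1 + y * + D [ m ] → x ≈ y [ s′ ]
  cancel-D x y e = unscale D (subst (λ k → x * + D ≈ y * + D [ k ]) m≡s′D (+-cancelˡ (+ 1) e))

  G≈0⇒K : G a ≈ + 0 [ s′ ] → K a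
  G≈0⇒K {a} e = π≈1⇒K (subst (_≈ + 1 [ m ]) (sym (π≡1+GD a))
    (+-congˡ (+ 1) (subst (λ k → G a * + D ≈ + 0 * + D [ k ]) (sym m≡s′D) (scale D e))))

  K⇒G≈0 : K a → G a ≈ + 0 [ s′ ]
  K⇒G≈0 {a} h = cancel-D (G a) (+ 0) (subst (_≈ + 1 [ m ]) (π≡1+GD a) (K⇒π≈1 h))

  τ : ℕ → ℤ → ℤ
  τ = orbit-sum f G

  τ-resp : ∀ y → a ≈ b [ r ] → τ y a ≈ τ y b [ s′ ]
  τ-resp zero    e = ≈-refl
  τ-resp (suc y) e = +-cong (G-resp (Q.iter-resp y e)) (τ-resp y e)

  σ≡ : ∀ y b → + σ y b ≡ + y + τ y b * + D
  σ≡ zero    b = sym (trans (ℤₚ.+-identityˡ _) (ℤₚ.*-zeroˡ (+ D)))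
  σ≡ (suc y) b = trans (pos-+ (π (iter f y b)) (σ y b))
    (trans (cong₂ _+_ (π≡1+GD (iter f y b)) (σ≡ y b)) (shape (G (iter f y b)) (+ D) (+ y) (τ y b)))
    where
    shape : ∀ g d y t → (+ 1 + g * d) + (y + t * d) ≡ (+ 1 + y) + (g + t) * d
    shape = solve-∀

  abstract
    -- The exponent that f^D carries at b, in units of D: f^D(b + c) ≡ f^D(b) + f^(t(b)·D)(c).
    t : ℤ → ℤ
    t b = + 1 + τ D b

    σ-D : ∀ b → + σ D b ≡ t b * + D
    σ-D b = trans (σ≡ D b) (shape (τ D b) (+ D))
      where
      shape : ∀ t d → d + t * d ≡ (+ 1 + t) * d
      shape = solve-∀

    t-resp : a ≈ b [ r ] → t a ≈ t b [ s′ ]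
    t-resp e = +-congˡ (+ 1) (τ-resp D e)

    -- `τ D` sums G over D consecutive points of an f-orbit modulo r. Since f^D is the identity
    -- there, starting one point later changes nothing.
    t-f : ∀ b → t (f b) ≈ t b [ s′ ]
    t-f b = combine₂ (+ 1) (+ 1) (shape (τ D (f b)) (τ D b) (G (iter f D b)) (G b))
      (≈-reflexive (orbit-sum-rotate f G D b)) (G-resp (D-fixes-mod-r b))
      where
      shape : ∀ x y g h → (+ 1 + x) - (+ 1 + y) ≡ + 1 * ((x + h) - (g + y)) + + 1 * (g - h)
      shape = solve-∀

  iter-D-multiple : ∀ i b → iter f (i ℕ.* D) b ≈ b [ r ]
  iter-D-multiple i b = Q.iter-multiple i (D-fixes-mod-r b)

  σ-resp : ∀ y → a ≈ b [ r ] → + σ y a ≈ + σ y b [ m ]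
  σ-resp         zero    e = ≈-refl
  σ-resp {a} {b} (suc y) e = subst₂ (_≈_[ m ])
    (sym (pos-+ (π (iter f y a)) (σ y a))) (sym (pos-+ (π (iter f y b)) (σ y b)))
    (+-cong (π-resp (Q.iter-resp y e)) (σ-resp y e))

  σ-+ : ∀ x y b → σ (x ℕ.+ y) b ≡ σ x (iter f y b) ℕ.+ σ y b
  σ-+ zero    y b = refl
  σ-+ (suc x) y b = trans (cong₂ ℕ._+_ (cong π (iter-+ f x y b)) (σ-+ x y b))
    (sym (ℕₚ.+-assoc (π (iter f x (iter f y b))) (σ x (iter f y b)) (σ y b)))

  σ-D-multiple : ∀ i b → + σ (i ℕ.* D) b ≈ + i * (t b * + D) [ m ]
  σ-D-multiple zero    b = ≈-reflexive (sym (ℤₚ.*-zeroˡ (t b * + D)))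
  σ-D-multiple (suc i) b = begin
    + σ (D ℕ.+ i ℕ.* D) b                              ≡⟨ cong +_ (σ-+ D (i ℕ.* D) b) ⟩
    + (σ D (iter f (i ℕ.* D) b) ℕ.+ σ (i ℕ.* D) b)     ≡⟨ pos-+ (σ D (iter f (i ℕ.* D) b)) (σ (i ℕ.* D) b) ⟩
    + σ D (iter f (i ℕ.* D) b) + + σ (i ℕ.* D) b
      ≈⟨ +-cong (σ-resp D (iter-D-multiple i b)) (σ-D-multiple i b) ⟩
    + σ D b + + i * (t b * + D)                        ≡⟨ cong (λ z → z + + i * (t b * + D)) (σ-D b) ⟩
    t b * + D + + i * (t b * + D)                      ≡⟨ shape (+ i) (t b * + D) ⟩
    + suc i * (t b * + D)                              ∎
    where
    open ≈-Reasoning m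
    shape : ∀ i x → x + i * x ≡ (+ 1 + i) * x
    shape = solve-∀

  -- By `π-σ`, π(a + b) sums π along 1 + G(a)·D points of the orbit of b: one point contributes 1 +
  -- G(b)·D, and each of G(a) blocks of length D contributes t(b)·D.
  G-+ : ∀ a b → G (a + b) ≈ G b + G a * t b [ s′ ]
  G-+ a b = cancel-D (G (a + b)) (G b + G a * t b) (begin
    + 1 + G (a + b) * + D               ≡⟨ π≡1+GD (a + b) ⟨
    + π (a + b)                         ≈⟨ π-σ a b ⟩
    + σ (π a) b                         ≡⟨ cong (λ y → + σ y b) (π≡suc a) ⟩
    + σ (suc (i ℕ.* D)) b               ≡⟨ pos-+ (π (iter f (i ℕ.* D) b)) (σ (i ℕ.* D) b) ⟩
    + π (iter f (i ℕ.* D) b) + + σ (i ℕ.* D) b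
      ≈⟨ +-cong (π-resp (iter-D-multiple i b)) (σ-D-multiple i b) ⟩
    + π b + + i * (t b * + D)           ≡⟨ cong (λ z → z + + i * (t b * + D)) (π≡1+GD b) ⟩
    (+ 1 + G b * + D) + + i * (t b * + D) ≡⟨ shape (G b) (+ i) (t b) (+ D) ⟩
    + 1 + (G b + + i * t b) * + D       ≡⟨ cong (λ x → + 1 + (G b + x * t b) * + D) (proj₂ (G-natural a)) ⟨
    + 1 + (G b + G a * t b) * + D       ∎)
    where
    open ≈-Reasoning m
    i : ℕ
    i = proj₁ (G-natural a)
    shape : ∀ g i t d → (+ 1 + g * d) + i * (t * d) ≡ + 1 + (g + i * t) * d
    shape = solve-∀

  -- f(1) − 1
  w : ℕ
  w = (f (+ 1) - + 1) %ℕ r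

  f1≈w+1 : f (+ 1) ≈ + w + + 1 [ r ]
  f1≈w+1 = ≈-trans (≈-reflexive (shape (f (+ 1)))) (+-congʳ (+ 1) (≈-residue (f (+ 1) - + 1) r))
    where
    shape : ∀ x → x ≡ (x - + 1) + + 1
    shape = solve-∀

  private
    module A = Affine {s′} G t w (K⇒G≈0 K-0) G-+
      (≈-trans (t-resp (≈-sym f1≈w+1)) (t-f (+ 1)))

  open A public using (gT≈g; G-multiple)

  -- G is linear on multiples of w, and rw lies in the kernel. Here r = k′ while s′ divides k, which
  -- is where coprimality acts.
  rG≈0 : + r * G (+ w) ≈ + 0 [ s′ ]
  rG≈0 = ≈-trans (≈-sym (G-multiple r)) (K⇒G≈0 (≈0⇒K (∣⇒≈ (ℕ∣.m∣m*n w))))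

  w∉K : ¬ K (+ w)
  w∉K h = non-smooth (≈-trans f1≈w+1 (+-congʳ (+ 1) (K⇒≈0 h)))

  ¬coprime : ¬ Coprime k k′
  ¬coprime c = w∉K (G≈0⇒K (cancel-coprime s′⊥r (G (+ w)) rG≈0))
    where
    r≡k′ : r ≡ k′
    r≡k′ = trans r≡k′r′ (trans (cong (k′ ℕ.*_) r′≡1) (ℕₚ.*-identityʳ k′))
    s′⊥r : Coprime s′ r
    s′⊥r (d∣s′ , d∣r) = c (ℕ∣.∣-trans d∣s′ s′∣k , subst (_ ∣_) r≡k′ d∣r)

-- Quotients that are automorphisms of ℤ/4

module IndexFour {n : ℕ} {f : ℤ → ℤ} (S : Skew n f)
  (quotient-smooth : f (+ 1) ≈ + 1 [ SkewTheory.r (SkewTheory.quotient S) ])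
  (non-smooth : ¬ f (+ 1) ≈ + 1 [ SkewTheory.r S ])
  (r′≡1 : SkewTheory.r (SkewTheory.quotient S) ≡ 1)
  (k′≡4 : NonSmooth.k′ S quotient-smooth non-smooth ≡ 4)
  where
  open Automorphism S quotient-smooth non-smooth r′≡1 public

  r≡4 : r ≡ 4
  r≡4 = trans r≡k′r′ (cong₂ ℕ._*_ k′≡4 r′≡1)

  to-mod-4 : a ≈ b [ r ] → a ≈ b [ 4 ]
  to-mod-4 {a} {b} = subst (a ≈ b [_]) r≡4

  from-mod-4 : a ≈ b [ 4 ] → a ≈ b [ r ]
  from-mod-4 {a} {b} = subst (a ≈ b [_]) (sym r≡4)

  -- Besides the identity, ℤ/4 has only the automorphism -1. It makes w = 2.
  f1≈3 : f (+ 1) ≈ + 3 [ 4 ]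
  f1≈3 = cases (f (+ 1) %ℕ 4) (n%ℕd<d (f (+ 1)) 4) (≈-residue (f (+ 1)) 4)
    where
    distinct : ∀ i j → i < 4 → j < 4 → i ≢ j → ¬ + i ≈ + j [ r ]
    distinct i j i<4 j<4 i≢j e = i≢j (small i<4 j<4 (to-mod-4 e))

    cases : ∀ x → x < 4 → f (+ 1) ≈ + x [ 4 ] → f (+ 1) ≈ + 3 [ 4 ]
    cases 0 _ e = contradiction (Q.injective (≈-trans (from-mod-4 e) (≈-sym Q.fixes-0)))
      (distinct 1 0 (from-yes (1 ℕ.<? 4)) (from-yes (0 ℕ.<? 4)) λ ())
    cases 1 _ e = contradiction (from-mod-4 e) non-smooth
    cases 2 _ e = contradiction (Q.injective (≈-trans (additive-mod-r (+ 1) (+ 1))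
        (≈-trans (from-mod-4 (≈-trans (+-cong e e) (∣⇒≈ ℕ∣.∣-refl))) (≈-sym Q.fixes-0))))
      (distinct 2 0 (from-yes (2 ℕ.<? 4)) (from-yes (0 ℕ.<? 4)) λ ())
    cases 3 _ e = e
    cases (suc (suc (suc (suc _)))) (s≤s (s≤s (s≤s (s≤s ())))) _

  w≡2 : w ≡ 2
  w≡2 = small {4} (subst (w <_) r≡4 (n%ℕd<d (f (+ 1) - + 1) r)) (from-yes (2 ℕ.<? 4))
    (≈-trans (≈-sym w-residue) (+-congʳ (- + 1) f1≈3))
    where
    w-residue : f (+ 1) - + 1 ≈ + w [ 4 ]
    w-residue = to-mod-4 (≈-residue (f (+ 1) - + 1) r)

  T u z : ℤ
  T = t (+ 1)
  u = G (+ 1)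
  z = G (+ 2)

  z≉0 : ¬ z ≈ + 0 [ s′ ]
  z≉0 e = w∉K (subst (λ x → K (+ x)) (sym w≡2) (G≈0⇒K e))

  zT≈z : z * T ≈ z [ s′ ]
  zT≈z = subst (λ x → G (+ x) * T ≈ G (+ x) [ s′ ]) w≡2 gT≈g

  2z≈0 : + 2 * z ≈ + 0 [ s′ ]
  2z≈0 = ≈-trans (≈-sym (subst (λ x → G (+ (2 ℕ.* x)) ≈ + 2 * G (+ x) [ s′ ]) w≡2 (G-multiple 2)))
    (K⇒G≈0 (≈0⇒K (from-mod-4 (∣⇒≈ ℕ∣.∣-refl))))

  z≈u+uT : z ≈ u + u * T [ s′ ]
  z≈u+uT = G-+ (+ 1) (+ 1)

  -- If T = 2e, then z ≡ zT = e·2z ≡ 0, although w is outside the kernel.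
  T-odd : T ≈ + 1 [ 2 ]
  T-odd = [ (λ e → contradiction (even⇒z≈0 T z e zT≈z 2z≈0) z≉0) , id ]′ (parity T)
    where
    even⇒z≈0 : ∀ T z → T ≈ + 0 [ 2 ] → z * T ≈ z [ s′ ] → + 2 * z ≈ + 0 [ s′ ] → z ≈ + 0 [ s′ ]
    even⇒z≈0 T z (witness e T≡) h₁ h₂ = combine₂ (- + 1) e
      (trans (shape T z) (trans (cong (λ x → - + 1 * (z * T - z) + z * x) T≡) (shape′ T z e))) h₁ h₂
      where
      shape : ∀ T z → z - + 0 ≡ - + 1 * (z * T - z) + z * (T - + 0)
      shape = solve-∀
      shape′ : ∀ T z e → - + 1 * (z * T - z) + z * (e * + 2) ≡ - + 1 * (z * T - z) + e * (+ 2 * z - + 0)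
      shape′ = solve-∀

  -- With T = 1 + 2e, z ≡ 2v for v = u(1 + e), so for odd p: z ≡ pz ≡ 2pv ≡ 0 modulo s′ ∣ 2p.
  k≢2p : ∀ p → k ≡ 2 ℕ.* p → ¬ (∃[ h ] p ≡ 1 ℕ.+ 2 ℕ.* h)
  k≢2p p k≡2p (h , p≡) = z≉0 (vanish u z T 2p≈0 T-odd z≈u+uT 2z≈0)
    where
    2p≈0 : + 2 * (+ 1 + + 2 * + h) ≈ + 0 [ s′ ]
    2p≈0 = subst (_≈ + 0 [ s′ ])
      (trans (cong +_ (trans k≡2p (cong (2 ℕ.*_) p≡)))
        (trans (pos-* 2 (1 ℕ.+ 2 ℕ.* h)) (cong (λ x → + 2 * (+ 1 + x)) (pos-* 2 h))))
      (∣⇒≈ s′∣k)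

    vanish : ∀ u z T → + 2 * (+ 1 + + 2 * + h) ≈ + 0 [ s′ ] → T ≈ + 1 [ 2 ] →
      z ≈ u + u * T [ s′ ] → + 2 * z ≈ + 0 [ s′ ] → z ≈ + 0 [ s′ ]
    vanish u z T h₁ (witness e T≡) h₂ h₃ = combine₃ (+ 1 + + 2 * + h) (u * (+ 1 + e)) (- + h)
      (trans (shape₁ u z T (+ h)) (trans (cong (λ x → (+ 1 + + 2 * + h) * (z - (u + u * T)) + (+ 1 + + 2 * + h) * u * (+ 2 + x) + - + h * (+ 2 * z - + 0)) T≡)
        (shape₂ u z T (+ h) e)))
      h₂ h₁ h₃
      where
      shape₁ : ∀ u z T h → z - + 0 ≡
        (+ 1 + + 2 * h) * (z - (u + u * T)) + (+ 1 + + 2 * h) * u * (+ 2 + (T - + 1)) + - h * (+ 2 * z - + 0)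
      shape₁ = solve-∀
      shape₂ : ∀ u z T h e →
        (+ 1 + + 2 * h) * (z - (u + u * T)) + (+ 1 + + 2 * h) * u * (+ 2 + e * + 2) + - h * (+ 2 * z - + 0) ≡
        (+ 1 + + 2 * h) * (z - (u + u * T)) + u * (+ 1 + e) * (+ 2 * (+ 1 + + 2 * h) - + 0) + - h * (+ 2 * z - + 0)
      shape₂ = solve-∀

-- The case n = 16

odd⇒1+2e : a ≈ + 1 [ 2 ] → ∃[ e ] a ≡ + 1 + e * + 2
odd⇒1+2e {a} (witness e a-1≡) = e , trans (shape a) (cong (λ x → + 1 + x) a-1≡)
  where
  shape : ∀ a → a ≡ + 1 + (a - + 1)
  shape = solve-∀

odd-square : a ≈ + 1 [ 2 ] → a * a ≈ + 1 [ 4 ]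
odd-square {a} a-odd = subst (λ x → x * x ≈ + 1 [ 4 ]) (sym (proj₂ half)) (witness (e + e * e) (shape e))
  where
  half : ∃[ e ] a ≡ + 1 + e * + 2
  half = odd⇒1+2e a-odd
  e : ℤ
  e = proj₁ half
  shape : ∀ e → (+ 1 + e * + 2) * (+ 1 + e * + 2) - + 1 ≡ (e + e * e) * + 4
  shape = solve-∀

-- In the application f(4) = 4v, f(1) = 4a + 3, f(3) = 4b + 1, y and y₃ are G(1) and G(3), and f^D
-- moves 1 and 3 by 4c and 4c₃. The equation between products forces v ≡ 3, the last equation then
-- gives 2a ≡ 2b, and so 2c ≡ 0, against c odd.
no-solution-mod-4 : ∀ v y y₃ a b c c₃ → v ≈ + 1 [ 2 ] → y ≈ + 1 [ 2 ] → c ≈ + 1 [ 2 ] →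
  y₃ ≈ + 3 * y [ 4 ] → c ≈ a * v + b [ 4 ] → c₃ ≈ b * v + a [ 4 ] →
  y * c₃ * v ≈ y₃ * c * v [ 4 ] → + 2 * b + y₃ * c₃ * v ≈ v + + 1 + + 2 * a + y * c * v [ 4 ] → ⊥
no-solution-mod-4 v y y₃ a b c c₃ v-odd y-odd c-odd y₃≈ c≈ c₃≈ e₁ e₂ =
  contradiction (small {4} (from-yes (2 ℕ.<? 4)) (from-yes (0 ℕ.<? 4)) 2≈0) λ ()
  where
  open ≈-Reasoning 4

  c₃v≈c : c₃ * v ≈ c [ 4 ]
  c₃v≈c = begin
    c₃ * v               ≈⟨ *-congʳ v c₃≈ ⟩
    (b * v + a) * v      ≡⟨ shape a b v ⟩
    b * (v * v) + a * v  ≈⟨ +-congʳ (a * v) (*-congˡ b (odd-square v-odd)) ⟩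
    b * + 1 + a * v      ≡⟨ shape′ a b v ⟩
    a * v + b            ≈⟨ c≈ ⟨
    c                    ∎
    where
    shape : ∀ a b v → (b * v + a) * v ≡ b * (v * v) + a * v
    shape = solve-∀
    shape′ : ∀ a b v → b * + 1 + a * v ≡ a * v + b
    shape′ = solve-∀

  yc≈3ycv : y * c ≈ + 3 * y * c * v [ 4 ]
  yc≈3ycv = begin
    y * c            ≈⟨ *-congˡ y c₃v≈c ⟨
    y * (c₃ * v)     ≡⟨ ℤₚ.*-assoc y c₃ v ⟨
    y * c₃ * v       ≈⟨ e₁ ⟩
    y₃ * c * v       ≈⟨ *-congʳ v (*-congʳ c y₃≈) ⟩
    + 3 * y * c * v  ∎

  y²c²≈1 : (y * y) * (c * c) ≈ + 1 [ 4 ]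
  y²c²≈1 = *-cong (odd-square y-odd) (odd-square c-odd)

  1≈3v : + 1 ≈ + 3 * v [ 4 ]
  1≈3v = begin
    + 1                              ≈⟨ y²c²≈1 ⟨
    (y * y) * (c * c)                ≡⟨ shape y c ⟩
    (y * c) * (y * c)                ≈⟨ *-congˡ (y * c) yc≈3ycv ⟩
    (y * c) * (+ 3 * y * c * v)      ≡⟨ shape′ y c v ⟩
    (y * y) * (c * c) * (+ 3 * v)    ≈⟨ *-congʳ (+ 3 * v) y²c²≈1 ⟩
    + 1 * (+ 3 * v)                  ≡⟨ ℤₚ.*-identityˡ (+ 3 * v) ⟩
    + 3 * v                          ∎
    where
    shape : ∀ y c → (y * y) * (c * c) ≡ (y * c) * (y * c)
    shape = solve-∀
    shape′ : ∀ y c v → (y * c) * (+ 3 * y * c * v) ≡ (y * y) * (c * c) * (+ 3 * v)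
    shape′ = solve-∀

  v≈3 : v ≈ + 3 [ 4 ]
  v≈3 = combine₂ {a′ = - + 4} {b′ = + 0} (- + 3) (+ 2 * v) (shape v) 1≈3v (witness (- + 1) refl)
    where
    shape : ∀ v → v - + 3 ≡ - + 3 * (+ 1 - + 3 * v) + + 2 * v * (- + 4 - + 0)
    shape = solve-∀

  2b≈2a : + 2 * b ≈ + 2 * a [ 4 ]
  2b≈2a = combine₂ {a′ = + 4} {b′ = + 0} (+ 1) (+ 1) (shape a b y c) balanced (∣⇒≈ ℕ∣.∣-refl)
    where
    shape : ∀ a b y c → + 2 * b - + 2 * a ≡
      + 1 * ((+ 2 * b + + 3 * y * c) - (+ 3 + + 1 + + 2 * a + y * c * + 3)) + + 1 * (+ 4 - + 0)
    shape = solve-∀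
    balanced : + 2 * b + + 3 * y * c ≈ + 3 + + 1 + + 2 * a + y * c * + 3 [ 4 ]
    balanced = begin
      + 2 * b + + 3 * y * c          ≈⟨ +-congˡ (+ 2 * b) (*-cong y₃≈ c₃v≈c) ⟨
      + 2 * b + y₃ * (c₃ * v)        ≡⟨ cong (λ x → + 2 * b + x) (ℤₚ.*-assoc y₃ c₃ v) ⟨
      + 2 * b + y₃ * c₃ * v          ≈⟨ e₂ ⟩
      v + + 1 + + 2 * a + y * c * v
        ≈⟨ +-cong (+-congʳ (+ 2 * a) (+-congʳ (+ 1) v≈3)) (*-congˡ (y * c) v≈3) ⟩
      + 3 + + 1 + + 2 * a + y * c * + 3  ∎

  2c≈0 : + 2 * c ≈ + 0 [ 4 ]
  2c≈0 = begin
    + 2 * c                        ≈⟨ *-congˡ (+ 2) c≈ ⟩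
    + 2 * (a * v + b)              ≈⟨ *-congˡ (+ 2) (+-congʳ b (*-congˡ a v≈3)) ⟩
    + 2 * (a * + 3 + b)            ≡⟨ shape a b ⟩
    + 6 * a + + 2 * b              ≈⟨ +-congˡ (+ 6 * a) 2b≈2a ⟩
    + 6 * a + + 2 * a              ≈⟨ witness (+ 2 * a) (shape′ a) ⟩
    + 0                            ∎
    where
    shape : ∀ a b → + 2 * (a * + 3 + b) ≡ + 6 * a + + 2 * b
    shape = solve-∀
    shape′ : ∀ a → (+ 6 * a + + 2 * a) - + 0 ≡ + 2 * a * + 4
    shape′ = solve-∀

  2≈0 : + 2 ≈ + 0 [ 4 ]
  2≈0 = ≈-trans (≈-sym (subst (_≈ + 2 [ 4 ]) (ℤₚ.*-comm c (+ 2)) (scale 2 c-odd))) 2c≈0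

module Order16 {n : ℕ} {f : ℤ → ℤ} (S : Skew n f)
  (quotient-smooth : f (+ 1) ≈ + 1 [ SkewTheory.r (SkewTheory.quotient S) ])
  (non-smooth : ¬ f (+ 1) ≈ + 1 [ SkewTheory.r S ])
  (r′≡1 : SkewTheory.r (SkewTheory.quotient S) ≡ 1)
  (k′≡4 : NonSmooth.k′ S quotient-smooth non-smooth ≡ 4)
  (k≡4 : NonSmooth.k S quotient-smooth non-smooth ≡ 4)
  where
  open IndexFour S quotient-smooth non-smooth r′≡1 k′≡4

  n≡16 : n ≡ 16
  n≡16 = trans n≡kr (cong₂ ℕ._*_ k≡4 r≡4)

  to-mod-16 : a ≈ b [ n ] → a ≈ b [ 16 ]
  to-mod-16 {a} {b} = subst (a ≈ b [_]) n≡16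

  from-mod-16 : a ≈ b [ 16 ] → a ≈ b [ n ]
  from-mod-16 {a} {b} = subst (a ≈ b [_]) (sym n≡16)

  s′≡4 : s′ ≡ 4
  s′≡4 = ℕₚ.≤-antisym (subst (s′ ≤_) k≡4 (∣⇒≤ s′∣k)) (subst (_≤ s′) k′≡4 k′≤s′)

  s′-to-4 : a ≈ b [ s′ ] → a ≈ b [ 4 ]
  s′-to-4 {a} {b} = subst (a ≈ b [_]) s′≡4

  z≉0-mod-4 : ¬ z ≈ + 0 [ 4 ]
  z≉0-mod-4 e = z≉0 (subst (z ≈ + 0 [_]) (sym s′≡4) e)

  e : ℤ
  e = proj₁ (odd⇒1+2e T-odd)

  z≈2u[1+e] : z ≈ + 2 * u * (+ 1 + e) [ 4 ]
  z≈2u[1+e] = ≈-trans (s′-to-4 z≈u+uT) (≈-reflexive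
    (trans (cong (λ x → u + u * x) (proj₂ (odd⇒1+2e T-odd))) (shape u e)))
    where
    shape : ∀ u e → u + u * (+ 1 + e * + 2) ≡ + 2 * u * (+ 1 + e)
    shape = solve-∀

  -- Since z ≢ 0 modulo s′ = 4, this makes u and 1 + e odd. Hence e is even, that is, T ≡ 1 (mod 4).
  even-product⇒z≈0 : u * (+ 1 + e) ≈ + 0 [ 2 ] → z ≈ + 0 [ 4 ]
  even-product⇒z≈0 h = ≈-trans z≈2u[1+e] (subst (_≈ + 0 [ 4 ]) (shape u (+ 1 + e)) (scale 2 h))
    where
    shape : ∀ u x → u * x * + 2 ≡ + 2 * u * x
    shape = solve-∀

  u-odd : u ≈ + 1 [ 2 ]
  u-odd = [ (λ h → contradiction (even-product⇒z≈0 (*-congʳ (+ 1 + e) h)) z≉0-mod-4) , id ]′ (parity u)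

  e-even : e ≈ + 0 [ 2 ]
  e-even = [ id , (λ h → contradiction (even-product⇒z≈0 (≈-trans (*-congˡ u (≈-trans (+-congˡ (+ 1) h) (∣⇒≈ ℕ∣.∣-refl)))
    (≈-reflexive (ℤₚ.*-zeroʳ u)))) z≉0-mod-4) ]′ (parity e)

  G3≈3u : G (+ 3) ≈ + 3 * u [ 4 ]
  G3≈3u = begin
    G (+ 3)                    ≈⟨ s′-to-4 (G-+ (+ 2) (+ 1)) ⟩
    u + z * T                  ≈⟨ +-congˡ u (s′-to-4 zT≈z) ⟩
    u + z                      ≈⟨ +-congˡ u z≈2u[1+e] ⟩
    u + + 2 * u * (+ 1 + e)    ≡⟨ shape u e ⟩
    + 3 * u + u * (e * + 2)    ≈⟨ +-congˡ (+ 3 * u) (*-congˡ u (scale 2 e-even)) ⟩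
    + 3 * u + u * (+ 0 * + 2)  ≡⟨ shape′ u ⟩
    + 3 * u                    ∎
    where
    open ≈-Reasoning 4
    shape : ∀ u e → u + + 2 * u * (+ 1 + e) ≡ + 3 * u + u * (e * + 2)
    shape = solve-∀
    shape′ : ∀ u → + 3 * u + u * (+ 0 * + 2) ≡ + 3 * u
    shape′ = solve-∀

  4∈K : ∀ y → K (y * + 4)
  4∈K y = ≈0⇒K (from-mod-4 (witness y (ℤₚ.+-identityʳ (y * + 4))))

  K⇒4∣ : ∀ {x} → x ≈ + 0 [ r ] → ∃[ y ] x ≡ y * + 4
  K⇒4∣ {x} h = _≈_[_].quotient (to-mod-4 h) , trans (sym (ℤₚ.+-identityʳ x)) (_≈_[_].equality (to-mod-4 h))

  offset : ∀ {x i} → x ≈ + i [ 4 ] → ∃[ y ] x ≡ y * + 4 + + i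
  offset {x} {i} (witness y h) = y , trans (shape x (+ i)) (cong (_+ + i) h)
    where
    shape : ∀ x i → x ≡ (x - i) + i
    shape = solve-∀

  f3≈1 : f (+ 3) ≈ + 1 [ 4 ]
  f3≈1 = begin
    f (+ 3)                        ≈⟨ to-mod-4 (additive-mod-r (+ 1) (+ 2)) ⟩
    f (+ 1) + f (+ 2)              ≈⟨ +-congˡ (f (+ 1)) (to-mod-4 (additive-mod-r (+ 1) (+ 1))) ⟩
    f (+ 1) + (f (+ 1) + f (+ 1))  ≈⟨ +-cong f1≈3 (+-cong f1≈3 f1≈3) ⟩
    + 9                            ≈⟨ witness (+ 2) refl ⟩
    + 1                            ∎
    where open ≈-Reasoning 4

  K⇒≈0-f4 : f (+ 4) ≈ + 0 [ r ]
  K⇒≈0-f4 = K⇒≈0 (K-f (4∈K (+ 1)))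

  v α β γ γ₃ : ℤ
  v  = proj₁ (K⇒4∣ K⇒≈0-f4)
  α  = proj₁ (offset f1≈3)
  β  = proj₁ (offset f3≈1)
  γ  = proj₁ (K⇒4∣ (K⇒≈0 (displacement∈K (+ 1))))
  γ₃ = proj₁ (K⇒4∣ (K⇒≈0 (displacement∈K (+ 3))))

  f4≡ : f (+ 4) ≡ v * + 4
  f4≡ = proj₂ (K⇒4∣ K⇒≈0-f4)

  f1≡ : f (+ 1) ≡ α * + 4 + + 3
  f1≡ = proj₂ (offset f1≈3)

  f3≡ : f (+ 3) ≡ β * + 4 + + 1
  f3≡ = proj₂ (offset f3≈1)

  displacement1≡ : displacement (+ 1) ≡ γ * + 4
  displacement1≡ = proj₂ (K⇒4∣ (K⇒≈0 (displacement∈K (+ 1))))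

  displacement3≡ : displacement (+ 3) ≡ γ₃ * + 4
  displacement3≡ = proj₂ (K⇒4∣ (K⇒≈0 (displacement∈K (+ 3))))

  f-4y : ∀ y → f (y * + 4) ≈ y * v * + 4 [ n ]
  f-4y y = begin
    f (y * + 4)    ≈⟨ iter-K-* 1 y (4∈K (+ 1)) ⟩
    y * f (+ 4)    ≡⟨ cong (λ x → y * x) f4≡ ⟩
    y * (v * + 4)  ≡⟨ ℤₚ.*-assoc y v (+ 4) ⟨
    y * v * + 4    ∎
    where open ≈-Reasoning n

  f-4y+a : ∀ y a → f (y * + 4 + a) ≈ y * v * + 4 + f a [ n ]
  f-4y+a y a = ≈-trans (4∈K y a) (+-congʳ (f a) (f-4y y))

  -- For even v, f(8) ≡ 8v ≡ 0 ≡ f(0) would contradict injectivity modulo 16.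
  v-odd : v ≈ + 1 [ 2 ]
  v-odd = [ (λ h → contradiction (small {16} (from-yes (8 ℕ.<? 16)) (from-yes (0 ℕ.<? 16)) (even⇒8≈0 h)) λ ()) , id ]′ (parity v)
    where
    open ≈-Reasoning n
    even⇒8≈0 : v ≈ + 0 [ 2 ] → + 8 ≈ + 0 [ 16 ]
    even⇒8≈0 h = to-mod-16 (injective (begin
      f (+ 8)          ≈⟨ f-4y (+ 2) ⟩
      + 2 * v * + 4    ≡⟨ shape v ⟩
      v * + 8          ≈⟨ from-mod-16 (scale 8 h) ⟩
      + 0              ≈⟨ fixes-0 ⟨
      f (+ 0)          ∎))
      where
      shape : ∀ v → + 2 * v * + 4 ≡ v * + 8
      shape = solve-∀

  -- Modulo 4, f acts as -1, so f² fixes 1; on the kernel f multiplies by v, and v² ≡ 1 (mod 4). D =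
  -- 1 would make f(1) ≡ 1 (mod 4).
  D≡2 : D ≡ 2
  D≡2 = ℕₚ.≤-antisym (∣⇒≤ (D-least 2 (f²1≈1 , subst (λ x → iter f 2 (+ x) ≈ + x [ n ]) (sym r≡4) f²4≈4)))
    (ℕₚ.≤∧≢⇒< D≥1 λ 1≡D → non-smooth (subst (λ i → iter f i (+ 1) ≈ + 1 [ r ]) (sym 1≡D) (proj₁ D-holds)))
    where
    f²1≈1 : f (f (+ 1)) ≈ + 1 [ r ]
    f²1≈1 = ≈-trans (Q.resp (from-mod-4 f1≈3)) (from-mod-4 f3≈1)

    f²4≈4 : f (f (+ 4)) ≈ + 4 [ n ]
    f²4≈4 = begin
      f (f (+ 4))   ≡⟨ cong f f4≡ ⟩
      f (v * + 4)   ≈⟨ f-4y v ⟩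
      v * v * + 4   ≈⟨ from-mod-16 (scale 4 (odd-square v-odd)) ⟩
      + 4           ∎
      where open ≈-Reasoning n

  mod-4-part : ∀ x y i → x * + 4 + i ≈ y * + 4 + i [ n ] → x ≈ y [ 4 ]
  mod-4-part x y i h = unscale 4 (to-mod-16 (combine₁ (+ 1) (shape x y i) h))
    where
    shape : ∀ x y i → x * + 4 - y * + 4 ≡ + 1 * ((x * + 4 + i) - (y * + 4 + i))
    shape = solve-∀

  double-step : ∀ a → displacement a + a ≡ f (f a)
  double-step a = trans (shape (iter f D a) a) (cong (λ i → iter f i a) D≡2)
    where
    shape : ∀ x a → (x - a) + a ≡ x
    shape = solve-∀

  γ≈ : γ ≈ α * v + β [ 4 ]
  γ≈ = mod-4-part γ (α * v + β) (+ 1) (begin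
    γ * + 4 + + 1                    ≡⟨ cong (_+ + 1) displacement1≡ ⟨
    displacement (+ 1) + + 1         ≡⟨ double-step (+ 1) ⟩
    f (f (+ 1))                      ≡⟨ cong f f1≡ ⟩
    f (α * + 4 + + 3)                ≈⟨ f-4y+a α (+ 3) ⟩
    α * v * + 4 + f (+ 3)            ≡⟨ cong (λ x → α * v * + 4 + x) f3≡ ⟩
    α * v * + 4 + (β * + 4 + + 1)    ≡⟨ shape (α * v) β (+ 1) ⟩
    (α * v + β) * + 4 + + 1          ∎)
    where
    open ≈-Reasoning n
    shape : ∀ x y i → x * + 4 + (y * + 4 + i) ≡ (x + y) * + 4 + i
    shape = solve-∀

  γ₃≈ : γ₃ ≈ β * v + α [ 4 ]
  γ₃≈ = mod-4-part γ₃ (β * v + α) (+ 3) (begin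
    γ₃ * + 4 + + 3                   ≡⟨ cong (_+ + 3) displacement3≡ ⟨
    displacement (+ 3) + + 3         ≡⟨ double-step (+ 3) ⟩
    f (f (+ 3))                      ≡⟨ cong f f3≡ ⟩
    f (β * + 4 + + 1)                ≈⟨ f-4y+a β (+ 1) ⟩
    β * v * + 4 + f (+ 1)            ≡⟨ cong (λ x → β * v * + 4 + x) f1≡ ⟩
    β * v * + 4 + (α * + 4 + + 3)    ≡⟨ shape (β * v) α (+ 3) ⟩
    (β * v + α) * + 4 + + 3          ∎)
    where
    open ≈-Reasoning n
    shape : ∀ x y i → x * + 4 + (y * + 4 + i) ≡ (x + y) * + 4 + i
    shape = solve-∀

  m∤2D : ¬ m ∣ 2 ℕ.* D
  m∤2D h = contradiction (∣⇒≤ (ℕ∣.*-cancelʳ-∣ D (subst (_∣ 2 ℕ.* D) m≡s′D h)))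
    (ℕₚ.<⇒≱ (subst (2 <_) (sym s′≡4) (from-yes (2 ℕ.<? 4))))

  -- With γ even, f^(2D) would move 1 by 8γ, a multiple of 16, so m would divide 2D; but m = 4D.
  γ-odd : γ ≈ + 1 [ 2 ]
  γ-odd = [ (λ h → contradiction (m-least (2 ℕ.* D) (fixes-1⇒Fixes (2 ℕ.* D) (even⇒fixes h))) m∤2D) , id ]′ (parity γ)
    where
    open ≈-Reasoning n
    shape : ∀ γ → + 2 * (γ * + 4) + + 1 ≡ γ * + 8 + + 1
    shape = solve-∀
    even⇒fixes : γ ≈ + 0 [ 2 ] → iter f (2 ℕ.* D) (+ 1) ≈ + 1 [ n ]
    even⇒fixes h = begin
      iter f (2 ℕ.* D) (+ 1)           ≈⟨ D-power 2 (+ 1) ⟩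
      + 2 * displacement (+ 1) + + 1   ≡⟨ cong (λ x → + 2 * x + + 1) displacement1≡ ⟩
      + 2 * (γ * + 4) + + 1            ≡⟨ shape γ ⟩
      γ * + 8 + + 1                    ≈⟨ +-congʳ (+ 1) (from-mod-16 (scale 8 h)) ⟩
      + 0 + + 1                        ∎

  -- As π(a) = 1 + G(a)·D, first G(a) applications of f^D move b by 4d each; the last f multiplies
  -- this kernel element by v.
  f-+ : ∀ a b d → displacement b ≡ d * + 4 → f (a + b) ≈ f a + (G a * d * v * + 4 + f b) [ n ]
  f-+ a b d disp≡ = ≈-trans (skew a b) (+-congˡ (f a) (begin
    iter f (π a) b                       ≡⟨ cong (λ j → iter f j b) (π≡suc a) ⟩
    f (iter f (i ℕ.* D) b)               ≈⟨ resp (D-power i b) ⟩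
    f (+ i * displacement b + b)         ≡⟨ cong (λ x → f (x + b)) (trans (cong (λ x → + i * x) disp≡) (sym (ℤₚ.*-assoc (+ i) d (+ 4)))) ⟩
    f (+ i * d * + 4 + b)                ≈⟨ f-4y+a (+ i * d) b ⟩
    + i * d * v * + 4 + f b              ≡⟨ cong (λ x → x * d * v * + 4 + f b) (proj₂ (G-natural a)) ⟨
    G a * d * v * + 4 + f b              ∎))
    where
    open ≈-Reasoning n
    i : ℕ
    i = proj₁ (G-natural a)

  -- Both sides come from f(4), expanded as f(1 + 3) and as f(3 + 1).
  commutation : u * γ₃ * v ≈ G (+ 3) * γ * v [ 4 ]
  commutation = mod-4-part (u * γ₃ * v) (G (+ 3) * γ * v) (f (+ 1) + f (+ 3))
    (subst₂ (_≈_[ n ]) (shape₁ (f (+ 1)) (f (+ 3)) (u * γ₃ * v)) (shape₂ (f (+ 1)) (f (+ 3)) (G (+ 3) * γ * v))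
      (≈-trans (≈-sym (f-+ (+ 1) (+ 3) γ₃ displacement3≡)) (f-+ (+ 3) (+ 1) γ displacement1≡)))
    where
    shape₁ : ∀ a b x → a + (x * + 4 + b) ≡ x * + 4 + (a + b)
    shape₁ = solve-∀
    shape₂ : ∀ a b x → b + (x * + 4 + a) ≡ x * + 4 + (a + b)
    shape₂ = solve-∀

  -- Both sides come from f(6), expanded as f(3 + 3) and as f(4 + 2) with f(2) = f(1 + 1).
  sixfold : + 2 * β + G (+ 3) * γ₃ * v ≈ v + + 1 + + 2 * α + u * γ * v [ 4 ]
  sixfold = mod-4-part (+ 2 * β + G (+ 3) * γ₃ * v) (v + + 1 + + 2 * α + u * γ * v) (+ 2) (begin
    (+ 2 * β + x) * + 4 + + 2                          ≡⟨ shape₁ β x ⟩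
    (β * + 4 + + 1) + (x * + 4 + (β * + 4 + + 1))      ≡⟨ cong (λ w → w + (x * + 4 + w)) f3≡ ⟨
    f (+ 3) + (x * + 4 + f (+ 3))                      ≈⟨ f-+ (+ 3) (+ 3) γ₃ displacement3≡ ⟨
    f (+ 6)                                            ≈⟨ f-4y+a (+ 1) (+ 2) ⟩
    + 1 * v * + 4 + f (+ 2)                            ≈⟨ +-congˡ (+ 1 * v * + 4) (f-+ (+ 1) (+ 1) γ displacement1≡) ⟩
    + 1 * v * + 4 + (f (+ 1) + (y * + 4 + f (+ 1)))    ≡⟨ cong (λ w → + 1 * v * + 4 + (w + (y * + 4 + w))) f1≡ ⟩
    + 1 * v * + 4 + ((α * + 4 + + 3) + (y * + 4 + (α * + 4 + + 3)))
                                                       ≡⟨ shape₂ α v y ⟩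
    (v + + 1 + + 2 * α + y) * + 4 + + 2                ∎)
    where
    open ≈-Reasoning n
    x y : ℤ
    x = G (+ 3) * γ₃ * v
    y = u * γ * v
    shape₁ : ∀ b x → (+ 2 * b + x) * + 4 + + 2 ≡ (b * + 4 + + 1) + (x * + 4 + (b * + 4 + + 1))
    shape₁ = solve-∀
    shape₂ : ∀ a v y → + 1 * v * + 4 + ((a * + 4 + + 3) + (y * + 4 + (a * + 4 + + 3))) ≡
      (v + + 1 + + 2 * a + y) * + 4 + + 2
    shape₂ = solve-∀

  impossible : ⊥
  impossible = no-solution-mod-4 v u (G (+ 3)) α β γ γ₃ v-odd u-odd γ-odd G3≈3u γ≈ γ₃≈ commutation sixfold

-- Quotients whose kernel has index 2

module IndexTwo {n : ℕ} {f : ℤ → ℤ} (S : Skew n f)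
  (quotient-smooth : f (+ 1) ≈ + 1 [ SkewTheory.r (SkewTheory.quotient S) ])
  (non-smooth : ¬ f (+ 1) ≈ + 1 [ SkewTheory.r S ])
  (r′≡2 : SkewTheory.r (SkewTheory.quotient S) ≡ 2)
  where
  open NonSmooth S quotient-smooth non-smooth public

  r≡k′2 : r ≡ k′ ℕ.* 2
  r≡k′2 = trans r≡k′r′ (cong (k′ ℕ.*_) r′≡2)

  even∈QK : ∀ y → Q.K (y * + 2)
  even∈QK y = Q.K-* y (subst (λ x → Q.K (+ x)) r′≡2 Q.r∈K)

  doubled : ∀ {x y} → x ≈ y [ k′ ] → x * + 2 ≈ y * + 2 [ r ]
  doubled {x} {y} e = subst (x * + 2 ≈ y * + 2 [_]) (sym r≡k′2) (scale 2 e)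

  halved : ∀ {x y} → x * + 2 ≈ y * + 2 [ r ] → x ≈ y [ k′ ]
  halved {x} {y} e = unscale 2 (subst (x * + 2 ≈ y * + 2 [_]) r≡k′2 e)

  half-displacement : ∃[ γ ] f (+ 1) ≡ γ * + 2 + + 1
  half-displacement = γ , trans (shape (f (+ 1))) (cong (_+ + 1) (_≈_[_].equality smooth))
    where
    smooth : f (+ 1) ≈ + 1 [ 2 ]
    smooth = subst (f (+ 1) ≈ + 1 [_]) r′≡2 quotient-smooth
    γ : ℤ
    γ = _≈_[_].quotient smooth
    shape : ∀ x → x ≡ (x - + 1) + + 1
    shape = solve-∀

  half-f2 : ∃[ v ] f (+ 2) ≡ v * + 2
  half-f2 = _≈_[_].quotient even , trans (sym (ℤₚ.+-identityʳ (f (+ 2)))) (_≈_[_].equality even)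
    where
    even : f (+ 2) ≈ + 0 [ 2 ]
    even = subst (f (+ 2) ≈ + 0 [_]) r′≡2 (Q.K⇒≈0 (Q.K-f (even∈QK (+ 1))))

  f-even : ∀ y → f (y * + 2) ≈ y * f (+ 2) [ r ]
  f-even y = Q.iter-K-* 1 y (even∈QK (+ 1))

  -- Otherwise f would send f(1) = 2γ + 1 to -2γ + (2γ + 1) = 1, so q = 2, and then r′ = 1.
  f2≉-2 : ¬ f (+ 2) ≈ - + 2 [ r ]
  f2≉-2 h = contradiction (trans (sym r′≡2) (q≡2⇒r′≡1 q≡2)) λ ()
    where
    open ≈-Reasoning r
    γ : ℤ
    γ = proj₁ half-displacement
    shape : ∀ γ → γ * - + 2 + (γ * + 2 + + 1) ≡ + 1
    shape = solve-∀
    f²1≈1 : f (f (+ 1)) ≈ + 1 [ r ]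
    f²1≈1 = begin
      f (f (+ 1))                  ≡⟨ cong f (proj₂ half-displacement) ⟩
      f (γ * + 2 + + 1)            ≈⟨ even∈QK γ (+ 1) ⟩
      f (γ * + 2) + f (+ 1)        ≈⟨ +-cong (≈-trans (f-even γ) (*-congˡ γ h)) (≈-reflexive (proj₂ half-displacement)) ⟩
      γ * - + 2 + (γ * + 2 + + 1)  ≡⟨ shape γ ⟩
      + 1                          ∎
    q≡2 : q ≡ 2
    q≡2 = ℕₚ.≤-antisym (∣⇒≤ (Q.m-least 2 (Q.fixes-1⇒Fixes 2 f²1≈1))) q≥2

  multiple-of-f2≉0 : ∀ j → 0 < j → j < k′ → ¬ + j * f (+ 2) ≈ + 0 [ r ]
  multiple-of-f2≉0 j 0<j j<k′ h = ℕₚ.<⇒≢ 0<j (sym (small j<k′ (ℕₚ.<-trans 0<j j<k′)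
    (halved (Q.injective (≈-trans (f-even (+ j)) (≈-trans h (≈-sym Q.fixes-0)))))))

  -- Halving turns f on 2ℤ/rℤ into multiplication by v on ℤ/k′. Injectivity leaves only units, and
  -- modulo 3 and 4 these are ±1.
  f2≈±2 : k′ ≡ 3 ⊎ k′ ≡ 4 → f (+ 2) ≈ + 2 [ r ] ⊎ f (+ 2) ≈ - + 2 [ r ]
  f2≈±2 = [ three , four ]′
    where
    v : ℤ
    v = proj₁ half-f2

    f2≈ : ∀ {x} l → k′ ≡ l → v ≈ x [ l ] → f (+ 2) ≈ x * + 2 [ r ]
    f2≈ {x} l k′≡l e = ≈-trans (≈-reflexive (proj₂ half-f2)) (doubled (subst (v ≈ x [_]) (sym k′≡l) e))

    small-multiple : ∀ l j x → k′ ≡ l → 0 < j → j < l → + (j ℕ.* x) ≈ + 0 [ l ] → ¬ v ≈ + x [ l ]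
    small-multiple l j x k′≡l 0<j j<l jx≈0 e = multiple-of-f2≉0 j 0<j (subst (j <_) (sym k′≡l) j<l)
      (≈-trans (*-congˡ (+ j) (f2≈ l k′≡l e)) (≈-trans (≈-reflexive (trans (sym (ℤₚ.*-assoc (+ j) (+ x) (+ 2))) (cong (_* + 2) (sym (pos-* j x)))))
        (doubled (subst (+ (j ℕ.* x) ≈ + 0 [_]) (sym k′≡l) jx≈0))))

    three : k′ ≡ 3 → f (+ 2) ≈ + 2 [ r ] ⊎ f (+ 2) ≈ - + 2 [ r ]
    three k′≡3 = cases (v %ℕ 3) (n%ℕd<d v 3) (≈-residue v 3)
      where
      cases : ∀ x → x < 3 → v ≈ + x [ 3 ] → f (+ 2) ≈ + 2 [ r ] ⊎ f (+ 2) ≈ - + 2 [ r ]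
      cases 0 _ e = contradiction e (small-multiple 3 1 0 k′≡3 (s≤s z≤n) (s≤s (s≤s z≤n)) ≈-refl)
      cases 1 _ e = inj₁ (f2≈ 3 k′≡3 e)
      cases 2 _ e = inj₂ (f2≈ 3 k′≡3 (≈-trans e (witness (+ 1) refl)))
      cases (suc (suc (suc _))) (s≤s (s≤s (s≤s ()))) _

    four : k′ ≡ 4 → f (+ 2) ≈ + 2 [ r ] ⊎ f (+ 2) ≈ - + 2 [ r ]
    four k′≡4 = cases (v %ℕ 4) (n%ℕd<d v 4) (≈-residue v 4)
      where
      cases : ∀ x → x < 4 → v ≈ + x [ 4 ] → f (+ 2) ≈ + 2 [ r ] ⊎ f (+ 2) ≈ - + 2 [ r ]
      cases 0 _ e = contradiction e (small-multiple 4 1 0 k′≡4 (s≤s z≤n) (s≤s (s≤s z≤n)) ≈-refl)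
      cases 1 _ e = inj₁ (f2≈ 4 k′≡4 e)
      cases 2 _ e = contradiction e (small-multiple 4 2 2 k′≡4 (s≤s z≤n) (s≤s (s≤s (s≤s z≤n))) (∣⇒≈ ℕ∣.∣-refl))
      cases 3 _ e = inj₂ (f2≈ 4 k′≡4 (≈-trans e (witness (+ 1) refl)))
      cases (suc (suc (suc (suc _)))) (s≤s (s≤s (s≤s (s≤s ())))) _

  module FixedEvens (f2≈2 : f (+ 2) ≈ + 2 [ r ]) where
    -- f(1) − 1
    γ w e Ω : ℤ
    γ = proj₁ half-displacement
    w = γ * + 2
    e = + π (+ 1)
    Ω = + π w

    even-multiple : ∀ i → + i * w ≡ + i * γ * + 2
    even-multiple i = sym (ℤₚ.*-assoc (+ i) γ (+ 2))

    iter-even : ∀ i y → iter f i (y * + 2) ≈ y * + 2 [ r ]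
    iter-even zero    y = ≈-refl
    iter-even (suc i) y = ≈-trans (Q.resp (iter-even i y)) (≈-trans (f-even y) (*-congˡ y f2≈2))

    iter-1 : ∀ i → iter f i (+ 1) ≈ + 1 + + i * w [ r ]
    iter-1 zero    = ≈-reflexive (cong (λ x → + 1 + x) (sym (ℤₚ.*-zeroˡ w)))
    iter-1 (suc i) = begin
      f (iter f i (+ 1))              ≈⟨ Q.resp (iter-1 i) ⟩
      f (+ 1 + + i * w)               ≡⟨ cong f (trans (ℤₚ.+-comm (+ 1) (+ i * w)) (cong (_+ + 1) (even-multiple i))) ⟩
      f (+ i * γ * + 2 + + 1)         ≈⟨ even∈QK (+ i * γ) (+ 1) ⟩
      f (+ i * γ * + 2) + f (+ 1)
        ≈⟨ +-cong (iter-even 1 (+ i * γ)) (≈-reflexive (proj₂ half-displacement)) ⟩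
      + i * γ * + 2 + (w + + 1)       ≡⟨ shape (+ i) γ ⟩
      + 1 + + suc i * w               ∎
      where
      open ≈-Reasoning r
      shape : ∀ i γ → i * γ * + 2 + (γ * + 2 + + 1) ≡ + 1 + (+ 1 + i) * (γ * + 2)
      shape = solve-∀

    σ-even : ∀ i y → + σ i (y * + 2) ≈ + i * + π (y * + 2) [ m ]
    σ-even zero    y = ≈-reflexive (sym (ℤₚ.*-zeroˡ (+ π (y * + 2))))
    σ-even (suc i) y = begin
      + (π (iter f i (y * + 2)) ℕ.+ σ i (y * + 2))    ≡⟨ pos-+ (π (iter f i (y * + 2))) (σ i (y * + 2)) ⟩
      + π (iter f i (y * + 2)) + + σ i (y * + 2)      ≈⟨ +-cong (π-resp (iter-even i y)) (σ-even i y) ⟩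
      + π (y * + 2) + + i * + π (y * + 2)             ≡⟨ shape (+ i) (+ π (y * + 2)) ⟩
      + suc i * + π (y * + 2)                         ∎
      where
      open ≈-Reasoning m
      shape : ∀ i x → x + i * x ≡ (+ 1 + i) * x
      shape = solve-∀

    -- Even numbers are fixed modulo r, so the orbit sum of π at 2y consists of π(a) equal terms
    -- π(2y).
    π-*-even : ∀ a y → + π (a + y * + 2) ≈ + π a * + π (y * + 2) [ m ]
    π-*-even a y = ≈-trans (π-σ a (y * + 2)) (σ-even (π a) y)

    -- Equals Ω^i modulo m by `P-0` and `P-suc`; `Σ-P` is the corresponding geometric sum.
    P : ℕ → ℤ
    P i = + π (+ i * w)

    P-0 : P 0 ≈ + 1 [ m ]
    P-0 = K⇒π≈1 (subst K (sym (ℤₚ.*-zeroˡ w)) K-0)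

    P-suc : ∀ i → P (suc i) ≈ P i * Ω [ m ]
    P-suc i = ≈-trans (≈-reflexive (cong (λ x → + π x) (shape (+ i) w))) (π-*-even (+ i * w) γ)
      where
      shape : ∀ i w → (+ 1 + i) * w ≡ i * w + w
      shape = solve-∀

    π-1+ : ∀ i → + π (+ 1 + + i * w) ≈ e * P i [ m ]
    π-1+ i = subst (λ x → + π (+ 1 + x) ≈ e * + π x [ m ]) (sym (even-multiple i)) (π-*-even (+ 1) (+ i * γ))

    Σ-P : ℕ → ℤ
    Σ-P zero    = + 0
    Σ-P (suc y) = P y + Σ-P y

    σ-1 : ∀ y → + σ y (+ 1) ≈ e * Σ-P y [ m ]
    σ-1 zero    = ≈-reflexive (sym (ℤₚ.*-zeroʳ e))
    σ-1 (suc y) = begin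
      + (π (iter f y (+ 1)) ℕ.+ σ y (+ 1))  ≡⟨ pos-+ (π (iter f y (+ 1))) (σ y (+ 1)) ⟩
      + π (iter f y (+ 1)) + + σ y (+ 1)    ≈⟨ +-cong (≈-trans (π-resp (iter-1 y)) (π-1+ y)) (σ-1 y) ⟩
      e * P y + e * Σ-P y                   ≡⟨ ℤₚ.*-distribˡ-+ e (P y) (Σ-P y) ⟨
      e * (P y + Σ-P y)                     ∎
      where open ≈-Reasoning m

    geometric : ∀ y → (Ω - + 1) * Σ-P y ≈ P y - + 1 [ m ]
    geometric zero    = ≈-trans (≈-reflexive (ℤₚ.*-zeroʳ (Ω - + 1))) (+-congʳ (- + 1) (≈-sym P-0))
    geometric (suc y) = combine₂ (+ 1) (- + 1) (shape Ω (P y) (Σ-P y) (P (suc y))) (geometric y) (P-suc y)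
      where
      shape : ∀ Ω p s p′ → (Ω - + 1) * (p + s) - (p′ - + 1) ≡
        + 1 * ((Ω - + 1) * s - (p - + 1)) + - + 1 * (p′ - p * Ω)
      shape = solve-∀

    -- π(1 + 1) is e times a geometric sum, and π(2)·π(-2) ≡ π(0) ≡ 1; so the sum times π(-2)
    -- inverts e.
    e⁻¹ : ℤ
    e⁻¹ = Σ-P (π (+ 1)) * + π (- + 1 * + 2)

    e-unit : e * e⁻¹ ≈ + 1 [ m ]
    e-unit = begin
      e * (Σ-P (π (+ 1)) * + π (- + 1 * + 2))   ≡⟨ ℤₚ.*-assoc e (Σ-P (π (+ 1))) (+ π (- + 1 * + 2)) ⟨
      e * Σ-P (π (+ 1)) * + π (- + 1 * + 2)     ≈⟨ *-congʳ (+ π (- + 1 * + 2)) (≈-trans (π-σ (+ 1) (+ 1)) (σ-1 (π (+ 1)))) ⟨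
      + π (+ 2) * + π (- + 1 * + 2)             ≈⟨ π-*-even (+ 2) (- + 1) ⟨
      + π (+ 0)                                 ≈⟨ K⇒π≈1 K-0 ⟩
      + 1                                       ∎
      where open ≈-Reasoning m

    -- π(w + 1), computed in both orders.
    Ω≈Σ : Ω ≈ Σ-P (π w) [ m ]
    Ω≈Σ = combine₃ e⁻¹ (Σ-P (π w)) (- Ω) (shape Ω (Σ-P (π w)) e e⁻¹) eΩ≈eΣ e-unit e-unit
      where
      shape : ∀ Ω s e e′ → Ω - s ≡ e′ * (e * Ω - e * s) + s * (e * e′ - + 1) + - Ω * (e * e′ - + 1)
      shape = solve-∀
      eΩ≈eΣ : e * Ω ≈ e * Σ-P (π w) [ m ]
      eΩ≈eΣ = begin
        e * Ω              ≈⟨ π-*-even (+ 1) γ ⟨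
        + π (+ 1 + w)      ≡⟨ cong (λ x → + π x) (ℤₚ.+-comm (+ 1) w) ⟩
        + π (w + + 1)      ≈⟨ π-σ w (+ 1) ⟩
        + σ (π w) (+ 1)    ≈⟨ σ-1 (π w) ⟩
        e * Σ-P (π w)      ∎
        where open ≈-Reasoning m

    i : ℕ
    i = F (even∈QK γ)

    Ω≡ : Ω ≡ + 1 + + i * + D
    Ω≡ = π≡1+FD (even∈QK γ)

    πw≡ : π w ≡ suc (i ℕ.* D)
    πw≡ = ℤₚ.+-injective (trans Ω≡ (cong (λ x → + 1 + x) (sym (pos-* i D))))

    -- f^(iD) fixes 1 modulo r and also sends it to 1 + iDw, so iDw lies in the kernel.
    P-iD : P (i ℕ.* D) ≈ + 1 [ m ]
    P-iD = K⇒π≈1 (≈0⇒K (+-cancelˡ (+ 1) (≈-trans (≈-sym (iter-1 (i ℕ.* D)))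
      (Q.iter-multiple i (proj₁ D-holds)))))

    -- `Ω≈Σ` and the geometric sum give (Ω - 1)Ω ≡ Ω^π(w) - 1. As π(w) = 1 + iD and Ω^(iD) ≡ 1, the
    -- right side is Ω - 1.
    square-zero : (Ω - + 1) * (Ω - + 1) ≈ + 0 [ m ]
    square-zero = combine₃ (Ω - + 1) (+ 1) Ω (shape Ω (Σ-P (π w)) (P (i ℕ.* D)))
      Ω≈Σ
      (≈-trans (geometric (π w)) (≈-trans (≈-reflexive (cong (λ y → P y - + 1) πw≡)) (+-congʳ (- + 1) (P-suc (i ℕ.* D)))))
      P-iD
      where
      shape : ∀ Ω s p → (Ω - + 1) * (Ω - + 1) - + 0 ≡
        (Ω - + 1) * (Ω - s) + + 1 * ((Ω - + 1) * s - (p * Ω - + 1)) + Ω * (p - + 1)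
      shape = solve-∀

    P≈1+jh : ∀ j → P j ≈ + 1 + + j * (Ω - + 1) [ m ]
    P≈1+jh zero = ≈-trans P-0 (≈-reflexive (cong (λ x → + 1 + x) (sym (ℤₚ.*-zeroˡ (Ω - + 1)))))
    P≈1+jh (suc j) = combine₃ (+ 1) Ω (+ j) (shape (P (suc j)) (P j) Ω (+ j)) (P-suc j) (P≈1+jh j) square-zero
      where
      shape : ∀ p′ p Ω j → p′ - (+ 1 + (+ 1 + j) * (Ω - + 1)) ≡
        + 1 * (p′ - p * Ω) + Ω * (p - (+ 1 + j * (Ω - + 1))) + j * ((Ω - + 1) * (Ω - + 1) - + 0)
      shape = solve-∀

    -- By `square-zero`, Ω^k′ ≡ 1 + k′(Ω - 1). But k′w = γ·2k′ = γr lies in the kernel, so Ω^k′ ≡ 1;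
    -- cancelling D from k′(Ω - 1) = k′iD leaves the modulus s′.
    k′i≈0 : + k′ * + i ≈ + 0 [ s′ ]
    k′i≈0 = unscale D (subst (λ x → + k′ * + i * + D ≈ + 0 * + D [ x ]) m≡s′D (begin
      + k′ * + i * + D                   ≡⟨ shape (+ k′) (+ i) (+ D) ⟩
      + k′ * ((+ 1 + + i * + D) - + 1)   ≡⟨ cong (λ x → + k′ * (x - + 1)) Ω≡ ⟨
      + k′ * (Ω - + 1)                   ≈⟨ +-cancelˡ (+ 1) (≈-trans (≈-sym (P≈1+jh k′)) P-k′) ⟩
      + 0                                ∎))
      where
      open ≈-Reasoning m
      shape : ∀ k i d → k * i * d ≡ k * ((+ 1 + i * d) - + 1)
      shape = solve-∀
      shape′ : ∀ k γ → k * (γ * + 2) ≡ γ * k * + 2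
      shape′ = solve-∀
      P-k′ : P k′ ≈ + 1 [ m ]
      P-k′ = K⇒π≈1 (≈0⇒K (≈-trans (≈-reflexive (shape′ (+ k′) γ)) (doubled {γ * + k′} {+ 0} (witness γ (ℤₚ.+-identityʳ (γ * + k′))))))

    w∉K : ¬ K w
    w∉K h = non-smooth (≈-trans (≈-reflexive (proj₂ half-displacement)) (+-congʳ (+ 1) (K⇒≈0 h)))

    ¬coprime : ¬ Coprime k k′
    ¬coprime coprime = w∉K (π≈1⇒K (subst (_≈ + 1 [ m ]) (sym Ω≡) (+-congˡ (+ 1)
      (subst (λ x → + i * + D ≈ + 0 * + D [ x ]) (sym m≡s′D) (scale D i≈0)))))
      where
      i≈0 : + i ≈ + 0 [ s′ ]
      i≈0 = cancel-coprime (λ (d∣s′ , d∣k′) → coprime (ℕ∣.∣-trans d∣s′ s′∣k , d∣k′)) (+ i) k′i≈0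

  impossible : k′ ≡ 3 ⊎ k′ ≡ 4 → ¬ Coprime k k′
  impossible k′≡3∨4 = [ FixedEvens.¬coprime , (λ h → contradiction h f2≉-2) ]′ (f2≈±2 k′≡3∨4)

-- Induction over the divisors of 8p

module _ {n : ℕ} {f : ℤ → ℤ} (S : Skew n f)
  (quotient-smooth : f (+ 1) ≈ + 1 [ SkewTheory.r (SkewTheory.quotient S) ])
  (non-smooth : ¬ f (+ 1) ≈ + 1 [ SkewTheory.r S ])
  where
  private module N = NonSmooth S quotient-smooth non-smooth

  no-obstruction : ∀ p x → N.r′ ≡ x → ¬ Obstruction p N.k N.k′ x
  no-obstruction p .1 r′≡1 (automorphism-coprime c)      = Automorphism.¬coprime S quotient-smooth non-smooth r′≡1 c
  no-obstruction p .1 r′≡1 (automorphism-2p k′≡4 k≡2p o) = IndexFour.k≢2p S quotient-smooth non-smooth r′≡1 k′≡4 p k≡2p o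
  no-obstruction p .1 r′≡1 (automorphism-16 k′≡4 k≡4)    = Order16.impossible S quotient-smooth non-smooth r′≡1 k′≡4 k≡4
  no-obstruction p .2 r′≡2 (index-2 c k′≡3∨4)            = IndexTwo.impossible S quotient-smooth non-smooth r′≡2 k′≡3∨4 c

  n∤8p : ∀ p → Prime p → ¬ n ∣ 8 ℕ.* p
  n∤8p p pp (divides j 8p≡jn) = no-obstruction p N.r′ refl (obstruction pp j N.k N.k′ N.r′
    (trans 8p≡jn (cong (j ℕ.*_) (trans N.n≡kr (cong (N.k ℕ.*_) N.r≡k′r′)))) N.3≤k′ N.k′≤k)

module _ {n : ℕ} {f : ℤ → ℤ} (S : Skew n f) where
  open SkewTheory S

  non-smooth⇒n≥2 : ¬ f (+ 1) ≈ + 1 [ r ] → 2 ≤ n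
  non-smooth⇒n≥2 h = ℕₚ.≤∧≢⇒< (ℕ.>-nonZero⁻¹ n) λ 1≡n → h (subst (f (+ 1) ≈ + 1 [_])
    (sym (ℕ∣.∣1⇒≡1 (subst (r ∣_) (sym 1≡n) r∣n))) (witness (f (+ 1) - + 1) (sym (ℤₚ.*-identityʳ _))))

smooth-step : ∀ {n f} (S : Skew n f) p → Prime p → n ∣ 8 ℕ.* p →
  (SkewTheory.r S < n → f (+ 1) ≈ + 1 [ SkewTheory.r (SkewTheory.quotient S) ]) → f (+ 1) ≈ + 1 [ SkewTheory.r S ]
smooth-step {n} {f} S p pp n∣8p below = decidable-stable (f (+ 1) ≈? + 1 [ SkewTheory.r S ]) λ h →
  n∤8p S (below (Index.index<modulus S (non-smooth⇒n≥2 S h))) h p pp n∣8p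

Smooth : ℕ → Set
Smooth n = ∀ (f : ℤ → ℤ) (S : Skew n f) → f (+ 1) ≈ + 1 [ SkewTheory.r S ]

smooth : ∀ p → Prime p → ∀ n → n ∣ 8 ℕ.* p → Smooth n
smooth p pp = <-rec (λ n → n ∣ 8 ℕ.* p → Smooth n) step
  where
  step : ∀ n → (∀ {l} → l < n → l ∣ 8 ℕ.* p → Smooth l) → n ∣ 8 ℕ.* p → Smooth n
  step n below n∣8p f S = smooth-step {n} {f} S p pp n∣8p λ r<n →
    below {SkewTheory.r S} r<n (ℕ∣.∣-trans (SkewTheory.r∣n S) n∣8p) f (SkewTheory.quotient S)

-- Lifting a permutation of residues to the integers

module Lift {k : ℕ} (φ : Permutation′ (suc k)) where
  size : ℕ
  size = suc k

  residue : ℤ → Fin size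
  residue z = fromℕ< (n%ℕd<d z size)

  f : ℤ → ℤ
  f z = + toℕ (φ ⟨$⟩ʳ residue z)

  toℕ-residue : ∀ z → + toℕ (residue z) ≈ z [ size ]
  toℕ-residue z = ≈-trans (≈-reflexive (cong +_ (toℕ-fromℕ< (n%ℕd<d z size)))) (≈-sym (≈-residue z size))

  toℕ-injective-mod : ∀ {x y : Fin size} → + toℕ x ≈ + toℕ y [ size ] → x ≡ y
  toℕ-injective-mod {x} {y} e = toℕ-injective (small (toℕ<n x) (toℕ<n y) e)

  residue-resp : a ≈ b [ size ] → residue a ≡ residue b
  residue-resp {a} {b} e = toℕ-injective-mod (≈-trans (toℕ-residue a) (≈-trans e (≈-sym (toℕ-residue b))))

  residue-toℕ : ∀ x → residue (+ toℕ x) ≡ x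
  residue-toℕ x = toℕ-injective-mod (toℕ-residue (+ toℕ x))

  toℕ-⊕ : ∀ (x y : Fin size) → + toℕ (x ⊕ y) ≈ + toℕ x + + toℕ y [ size ]
  toℕ-⊕ x y = ≈-trans (≈-reflexive (cong +_ (toℕ-fromℕ< (m%n<n (toℕ x ℕ.+ toℕ y) size))))
    (≈-sym (≈-residue (+ (toℕ x ℕ.+ toℕ y)) size))

  residue-+ : ∀ a b → residue (a + b) ≡ residue a ⊕ residue b
  residue-+ a b = toℕ-injective-mod (≈-trans (toℕ-residue (a + b)) (≈-sym
    (≈-trans (toℕ-⊕ (residue a) (residue b)) (+-cong (toℕ-residue a) (toℕ-residue b)))))

  residue-iter : ∀ i z → residue (iter f i z) ≡ pow φ i (residue z)
  residue-iter zero    z = refl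
  residue-iter (suc i) z = trans (residue-toℕ (φ ⟨$⟩ʳ residue (iter f i z))) (cong (φ ⟨$⟩ʳ_) (residue-iter i z))

  iter≈pow : ∀ i z → iter f i z ≈ + toℕ (pow φ i (residue z)) [ size ]
  iter≈pow i z = ≈-trans (≈-sym (toℕ-residue (iter f i z))) (≈-reflexive (cong (λ x → + toℕ x) (residue-iter i z)))

  powerAt⇒skew : ∀ a i → PowerAt φ (residue a) i → ∀ b → f (a + b) ≈ f a + iter f i b [ size ]
  powerAt⇒skew a i h b = begin
    + toℕ (φ ⟨$⟩ʳ residue (a + b))                       ≡⟨ cong (λ x → + toℕ (φ ⟨$⟩ʳ x)) (residue-+ a b) ⟩
    + toℕ (φ ⟨$⟩ʳ (residue a ⊕ residue b))               ≡⟨ cong (λ x → + toℕ x) (h (residue b)) ⟩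
    + toℕ ((φ ⟨$⟩ʳ residue a) ⊕ pow φ i (residue b))     ≈⟨ toℕ-⊕ (φ ⟨$⟩ʳ residue a) (pow φ i (residue b)) ⟩
    f a + + toℕ (pow φ i (residue b))                    ≈⟨ +-congˡ (f a) (iter≈pow i b) ⟨
    f a + iter f i b                                     ∎
    where open ≈-Reasoning size

  lift : IsSkewMorphism φ → ∀ m → IsOrder φ m → Skew size f
  lift (φ0≡0 , powers) m (1≤m , φ^m , _) = record
    { nonZero = _
    ; resp    = λ e → ≈-reflexive (cong (λ x → + toℕ (φ ⟨$⟩ʳ x)) (residue-resp e))
    ; fixes-0 = ≈-reflexive (cong (λ x → + toℕ x) φ0≡0)
    ; π       = λ a → proj₁ (powers (residue a))
    ; π≥1     = λ a → proj₁ (proj₂ (powers (residue a)))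
    ; skew    = λ a b → powerAt⇒skew a (proj₁ (powers (residue a))) (proj₂ (proj₂ (powers (residue a)))) b
    ; N       = m
    ; N≥1     = 1≤m
    ; f^N     = λ a → ≈-trans (iter≈pow m a) (≈-trans (≈-reflexive (cong (λ x → + toℕ x) (φ^m (residue a)))) (toℕ-residue a))
    }

theorem7p1 : (p k : ℕ) → Prime p → 8 ℕ.* p ≡ suc k →
    (φ : Permutation′ (suc k)) → IsSkewMorphism φ → IsCosetPreserving φ
theorem7p1 p k pp 8p≡n φ isSkew a i j (m₁ , order₁ , 1≤i , i≤m₁ , powerAt-a) (m₂ , order₂ , 1≤j , j≤m₂ , powerAt-φa) =
  -- The values range over 1, ..., ord φ, so both are lowered by 1 before being compared as residues
  -- below `m`.
  trans (sym (ℕₚ.m+[n∸m]≡n 1≤i)) (trans (cong suc (small (pred< 1≤i i≤m₁ order₁) (pred< 1≤j j≤m₂ order₂)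
    (+-cancelˡ (+ 1) (subst₂ (λ x y → + x ≈ + y [ m ]) (sym (ℕₚ.m+[n∸m]≡n 1≤i)) (sym (ℕₚ.m+[n∸m]≡n 1≤j)) i≈j))))
    (ℕₚ.m+[n∸m]≡n 1≤j))
  where
  open Lift φ
  S : Skew size f
  S = lift isSkew m₁ order₁
  open SkewTheory S hiding (n-nonZero)

  A : ℤ
  A = + toℕ a

  fA≈A : f A ≈ A [ r ]
  fA≈A = SkewTheory.fixes-1⇒Fixes quotient 1 (smooth p pp size (subst (size ∣_) (sym 8p≡n) ℕ∣.∣-refl) f S) A

  -- The lift carries its own choice of exponents; any other exponent valid at the same point is
  -- compared with it at 1.
  exponent≈π : ∀ x e → PowerAt φ (residue x) e → + e ≈ + π x [ m ]
  exponent≈π x e h = exponent-injective (+-cancelˡ (f x) (≈-trans (≈-sym (powerAt⇒skew x e h (+ 1))) (skew x (+ 1))))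

  i≈j : + i ≈ + j [ m ]
  i≈j = begin
    + i          ≈⟨ exponent≈π A i (subst (λ x → PowerAt φ x i) (sym (residue-toℕ a)) powerAt-a) ⟩
    + π A        ≈⟨ π-resp fA≈A ⟨
    + π (f A)    ≈⟨ exponent≈π (f A) j (subst (λ x → PowerAt φ x j) (sym residue-fA) powerAt-φa) ⟨
    + j          ∎
    where
    open ≈-Reasoning m
    residue-fA : residue (f A) ≡ φ ⟨$⟩ʳ a
    residue-fA = trans (residue-toℕ (φ ⟨$⟩ʳ residue A)) (cong (φ ⟨$⟩ʳ_) (residue-toℕ a))

  -- The power f^m moves no point, so the minimality clause of `IsOrder` excludes m < l.
  order≤m : ∀ l → IsOrder φ l → l ≤ m
  order≤m l (_ , _ , minimal) = ℕₚ.≮⇒≥ λ m<l →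
    let x , moved = minimal m m≥1 m<l in
    moved (toℕ-injective-mod (subst (λ y → + toℕ (pow φ m y) ≈ + toℕ x [ size ]) (residue-toℕ x)
      (≈-trans (≈-sym (iter≈pow m (+ toℕ x))) (f^m (+ toℕ x)))))

  pred< : ∀ {e l} → 1 ≤ e → e ≤ l → IsOrder φ l → e ∸ 1 < m
  pred< {e} {l} 1≤e e≤l o = subst (_≤ m) (sym (ℕₚ.m+[n∸m]≡n 1≤e)) (ℕₚ.≤-trans e≤l (order≤m l o))
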